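{- For every positive integer $n$, the inverse Kazhdan--Lusztig polynomial $Q_{T_n}(t)$ of the thagomizer matroid $T_n$ is log-concave.
   Context: The thagomizer matroid $T_n$ is the graphic matroid of $K_{1,1,n}$ (vertices $A,B,1,\dots,n$, edges $AB,Aj,Bj$ for $1\le j\le n$). For a loopless matroid $\mathrm M$ (lattice of flats $\mathcal L(\mathrm M)$, characteristic polynomial $\chi$, restriction $\mathrm M|_F$, contraction $\mathrm M/F$), the inverse Kazhdan--Lusztig polynomial $Q_{\mathrm M}(t)\in\mathbb Z[t]$ is the unique polynomial with $Q_{\mathrm M}=1$ if $\operatorname{rk}\mathrm M=0$, $\deg Q_{\mathrm M}<\tfrac12\operatorname{rk}\mathrm M$ if $\operatorname{rk}\mathrm M>0$, and $t^{\operatorname{rk}\mathrm M}(-1)^{\operatorname{rk}\mathrm M}Q_{\mathrm M}(t^{ -1})=\sum_{F\in\mathcal L(\mathrm M)}(-1)^{\operatorname{rk}\mathrm M|_F}Q_{\mathrm M|_F}(t)\,t^{\operatorname{rk}\mathrm M/F}\chi_{\mathrm M/F}(t^{ -1})$. A polynomial $\sum_{i=0}^m a_it^i$ is log-concave if $a_i^2\ge a_{i-1}a_{i+1}$ for all $1\le i\le m-1$. -}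

module Defs where

open import Data.Bool using (Bool; true; false; if_then_else_; _∧_; _∨_; not)
open import Data.Nat as ℕ using (ℕ; zero; suc; _∸_; _<ᵇ_; _≡ᵇ_)
open import Data.Integer as ℤ using (ℤ; +_; -_; _≤_)
open import Data.Product using (_×_; _,_; proj₁; proj₂)
open import Data.List as List using (List; []; _∷_; filter; map; foldr; upTo; allFin; concatMap)
open import Data.Vec as Vec using (Vec; []; _∷_; lookup)
open import Data.Fin using (Fin; toℕ)
open import Data.Fin.Subset using (Subset; _∪_; _─_; ⁅_⁆; ∣_∣; ⊤)
open import Data.Bool.Properties using (T?)

Poly : Set
Poly = List ℤ

coeff : Poly → ℕ → ℤ
coeff []       _       = + 0
coeff (a ∷ _)  zero    = a
coeff (_ ∷ p)  (suc i) = coeff p i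

_⊕_ : Poly → Poly → Poly
[]      ⊕ q       = q
(a ∷ p) ⊕ []      = a ∷ p
(a ∷ p) ⊕ (b ∷ q) = (a ℤ.+ b) ∷ (p ⊕ q)

scale : ℤ → Poly → Poly
scale c = map (c ℤ.*_)

_⊗_ : Poly → Poly → Poly
[]      ⊗ q = []
(a ∷ p) ⊗ q = scale a q ⊕ (+ 0 ∷ (p ⊗ q))

polySum : List Poly → Poly
polySum = foldr _⊕_ []

monomial : ℕ → Poly
monomial zero    = + 1 ∷ []
monomial (suc k) = + 0 ∷ monomial k

sign : ℕ → ℤ
sign zero    = + 1
sign (suc k) = - sign k

-- t^d p(t^{-1})  (for deg p ≤ d)
recip : ℕ → Poly → Poly
recip d p = map (λ i → coeff p (d ∸ i)) (upTo (suc d))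

truncBelowHalf : ℕ → Poly → Poly
truncBelowHalf r p = map (λ i → coeff p i) (filter (λ i → (2 ℕ.* i) ℕ.<? r) (upTo r))

-- a_i^2 ≥ a_{i-1} a_{i+1} for all i ≥ 1 (coefficients beyond the degree are 0,
-- so this is equivalent to the condition for 1 ≤ i ≤ deg - 1)
LogConcave : Poly → Set
LogConcave p = ∀ i → coeff p i ℤ.* coeff p (suc (suc i)) ≤ coeff p (suc i) ℤ.* coeff p (suc i)

allSubsets : (m : ℕ) → List (Subset m)
allSubsets zero    = [] ∷ []
allSubsets (suc m) = concatMap (λ s → (false ∷ s) ∷ (true ∷ s) ∷ []) (allSubsets m)

mem : {m : ℕ} → Fin m → Subset m → Bool
mem i s = lookup s i

subsetᵇ : {m : ℕ} → Subset m → Subset m → Bool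
subsetᵇ []      []      = true
subsetᵇ (x ∷ s) (y ∷ t) = (not x ∨ y) ∧ subsetᵇ s t

eqᵇ : {m : ℕ} → Subset m → Subset m → Bool
eqᵇ s t = subsetᵇ s t ∧ subsetᵇ t s

allᵇ : {A : Set} → (A → Bool) → List A → Bool
allᵇ f = foldr (λ x b → f x ∧ b) true

-- Matroids, given by a rank function.  The ground set is a subset
-- `ground` of Fin m; the rank function is only consulted on subsets of
-- the ground set.

record Matroid : Set where
  field
    m      : ℕ
    ground : Subset m
    rk     : Subset m → ℕ

open Matroid public

rank : Matroid → ℕ
rank M = rk M (ground M)

isFlat : (M : Matroid) → Subset (m M) → Bool
isFlat M F =
  subsetᵇ F (ground M) ∧
  allᵇ (λ e → not (mem e (ground M)) ∨ mem e F ∨ (rk M F <ᵇ rk M (F ∪ ⁅ e ⁆)))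
       (allFin (m M))

flats : (M : Matroid) → List (Subset (m M))
flats M = filter (λ F → T? (isFlat M F)) (allSubsets (m M))

restrict : (M : Matroid) → Subset (m M) → Matroid
restrict M F = record { m = m M ; ground = F ; rk = rk M }

contract : (M : Matroid) → Subset (m M) → Matroid
contract M F = record { m = m M ; ground = ground M ─ F
                      ; rk = λ X → rk M (X ∪ F) ∸ rk M F }

charPoly : Matroid → Poly
charPoly M =
  polySum (map (λ X → scale (sign ∣ X ∣) (monomial (rank M ∸ rk M X)))
               (filter (λ X → T? (subsetᵇ X (ground M)))
                       (allSubsets (m M))))

-- Inverse Kazhdan–Lusztig polynomial.
-- From the defining identity, the F = E term is (-1)^r Q_M(t), and
-- t^r Q_M(t^{-1}) only has degrees > r/2 while Q_M has degrees < r/2, so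
--   Q_M(t) = (-1)^{r+1} · [degree < r/2 part of]
--            Σ_{F flat, F ≠ E} (-1)^{rk F} Q_{M|F}(t) t^{rk M/F} χ_{M/F}(t^{-1}).
-- Recursion is on a fuel parameter exceeding |E| (proper flats are
-- strictly smaller), which is supplied in `invKL`.

invKLaux : ℕ → Matroid → Poly
invKLaux zero    M = + 1 ∷ []
invKLaux (suc k) M with rank M
... | zero  = + 1 ∷ []
... | suc r =
  scale (sign r)
    (truncBelowHalf (suc r)
      (polySum (map (λ F → scale (sign (rk M F))
                              (invKLaux k (restrict M F) ⊗
                               recip (rank (contract M F)) (charPoly (contract M F))))
                    (filter (λ F → T? (not (eqᵇ F (ground M))))
                            (flats M)))))

invKL : Matroid → Poly
invKL M = invKLaux (suc (m M)) M

-- Graphic matroids.  A graph on vertices 0,…,nv-1 with edges indexed by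
-- Fin k.  rk X = nv - (number of connected components of (V, X)),
-- the components being computed by label merging (union–find).

Labels : Set
Labels = ℕ → ℕ

mergeEdge : Labels → ℕ × ℕ → Labels
mergeEdge ℓ (u , w) v = if ℓ v ≡ᵇ ℓ w then ℓ u else ℓ v

components : (nv : ℕ) → List (ℕ × ℕ) → ℕ
components nv es =
  List.length (filter (λ v → v ℕ.≟ (final v)) (upTo nv))
  where final : Labels
        final = List.foldl mergeEdge (λ v → v) es

selectEdges : {k : ℕ} → Vec (ℕ × ℕ) k → Subset k → List (ℕ × ℕ)
selectEdges []       []          = []
selectEdges (e ∷ es) (true ∷ s)  = e ∷ selectEdges es s
selectEdges (e ∷ es) (false ∷ s) = selectEdges es s

graphicMatroid : (nv : ℕ) → List (ℕ × ℕ) → Matroid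
graphicMatroid nv es = record
  { m = List.length es ; ground = ⊤
  ; rk = λ X → nv ∸ components nv (selectEdges (Vec.fromList es) X) }

-- Thagomizer matroid T_n = M(K_{1,1,n}).
-- Vertices A = 0, B = 1, and j ↦ j+1 (j = 1..n); edges AB, Aj, Bj.

thagoEdges : ℕ → List (ℕ × ℕ)
thagoEdges n = (0 , 1) ∷ concatMap (λ j → (0 , suc j) ∷ (1 , suc j) ∷ []) (map suc (upTo n))

thagomizer : ℕ → Matroid
thagomizer n = graphicMatroid (suc (suc n)) (thagoEdges n)

{-# OPTIONS --safe #-}
module Submission where

-- The flats of T_n are: AB together with s full spikes (restriction T_s, contraction Boolean of
-- rank n - s up to parallel edges), and s single edges from distinct spikes (restriction Boolean,
-- contraction T_{n-s} up to parallel edges).  Since Q = 1 for Boolean matroids, the defining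
-- identity becomes
--   t^{n+1} Q_n(1/t) = Σ_s C(n,s) (t-1)^{n-s} Q_s(t) - (1-t)(1+2t)^n,
-- and it is solved by Q_n = Σ_s C(n,s) R_s, where R_s is the part of degree ≤ s/2 of (1-t)(1+t)^s.
-- Summing the coefficients gives
--   (n+1) [t^k] Q_n = C(n+1,k) v(n+1-k, n-2k),   v(N,d) = [x^d] (1+x)^N / (1-x)^2.
-- Every row a = v(N,·) satisfies a_i a_{j+1} ≤ a_{i+1} a_j for i ≤ j, because 1/(1-x)^2 does and
-- multiplication by 1 + x preserves this; expanding v(N+1,·) and v(N+2,·) in terms of v(N,·), it
-- yields v(N,d) v(N+2,d+4) ≤ v(N+1,d+2)^2.

open import Defs
open import Data.Bool using (Bool; true; false; if_then_else_; _∧_; _∨_; not; T)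
open import Data.Bool.Properties using (T?; ∧-zeroʳ; ∧-identityʳ; ∨-zeroʳ; ∨-identityʳ; ∨-assoc)
open import Data.Fin using (Fin; zero; suc)
open import Data.Fin.Subset using (Subset; _∪_; _─_; ⁅_⁆; ∣_∣; ⊤)
open import Data.Fin.Subset.Properties using (∪-identityʳ)
open import Data.Integer as ℤ using (ℤ; +_; -_)
import Data.Integer.Properties as ℤ
open import Data.Integer.Tactic.RingSolver using () renaming (solve-∀ to ring)
open import Data.List as List using (List; []; _∷_; filter; map; upTo; applyUpTo; allFin; tabulate; concatMap; length)
import Data.List.Properties as List
open import Data.List.Relation.Unary.All as All using (All; []; _∷_)
import Data.List.Relation.Unary.All.Properties as All
open import Data.List.Relation.Unary.AllPairs using ([]; _∷_)
open import Data.List.Relation.Unary.Unique.Propositional using (Unique)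
import Data.List.Relation.Unary.Unique.Propositional.Properties as Unique
open import Data.Nat as ℕ using (ℕ; zero; suc; _∸_; _≤_; _<_; z≤n; s≤s; _≤ᵇ_; _<ᵇ_; _≡ᵇ_; _!)
import Data.Nat.Properties as ℕ
open import Data.Nat.Tactic.RingSolver using () renaming (solve-∀ to semiring)
open import Data.Product using (∃; _×_; _,_; proj₁; proj₂)
open import Data.Sum using (_⊎_; inj₁; inj₂)
import Data.Vec as Vec
open import Data.Vec using ([]; _∷_)
open import Function using (_∘_; id)
open import Relation.Binary.PropositionalEquality using (_≡_; _≢_; _≗_; refl; sym; trans; cong; cong₂; subst; subst₂; module ≡-Reasoning)
open import Relation.Nullary using (yes; no; Dec; ¬_; contradiction)

-- Polynomials as coefficient sequences

-- The identity is used only in degrees at most n/2. There its left side vanishes, the recursion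
-- behind `invKL` reads no other degrees, and R_s may be replaced by all of (1-t)(1+t)^s: umbrally
-- its factor becomes t^{n-s}, which pushes the discarded part above degree n/2. Since the index
-- shift E acts on (1-t)(1+t)^s as 1 + t, the operator t + E is 1 + 2t, and (1-t)(1+2t)^n results.
-- The shape of the final inequality is forced: going from k to k+1 moves (n+1-k, n-2k) by (-1,-2),
-- so three consecutive coefficients lie on that diagonal, and the other factor C(n+1,k) is
-- log-concave in k. On the matroid side, restrictions keep the ambient edge set and only shrink
-- `ground`. The induction therefore runs over edge sets inside one fixed K_{1,1,n}, of the two
-- shapes met by restricting: AB with full spikes, and at most one edge from each spike.
-- Characteristic polynomials are subset sums that factor spike by spike, so parallel edges are
-- handled without simplifying the matroid.

Seq : Set
Seq = ℕ → ℤ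

infixl 6 _⊞_
infixr 7 _⊙_

_⊞_ : Seq → Seq → Seq
(f ⊞ g) i = f i ℤ.+ g i

_⊙_ : ℤ → Seq → Seq
(z ⊙ f) i = z ℤ.* f i

0S : Seq
0S _ = + 0

shift : Seq → Seq
shift f zero    = + 0
shift f (suc i) = f i

tpow : ℕ → Seq
tpow zero    zero    = + 1
tpow zero    (suc _) = + 0
tpow (suc a) = shift (tpow a)

-- Multiplication by `a + b t`. Fixed polynomials act as linear operators, so their powers are
-- `iter` and commutativity of multiplication becomes `Commute`.
op : ℤ → ℤ → Seq → Seq
op a b f = a ⊙ f ⊞ b ⊙ shift f

iter : (Seq → Seq) → ℕ → Seq → Seq
iter F zero    f = f
iter F (suc n) f = F (iter F n f)

iter-inner : ∀ F n f → iter F (suc n) f ≡ iter F n (F f)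
iter-inner F zero    f = refl
iter-inner F (suc n) f = cong F (iter-inner F n f)

⊞-cong : ∀ {f f′ g g′} → f ≗ f′ → g ≗ g′ → f ⊞ g ≗ f′ ⊞ g′
⊞-cong p q i = cong₂ ℤ._+_ (p i) (q i)

⊙-cong : ∀ z {f g} → f ≗ g → z ⊙ f ≗ z ⊙ g
⊙-cong z p i = cong (z ℤ.*_) (p i)

⊞-interchange : ∀ f g h k → (f ⊞ g) ⊞ (h ⊞ k) ≗ (f ⊞ h) ⊞ (g ⊞ k)
⊞-interchange f g h k i = eq (f i) (g i) (h i) (k i)
  where
  eq : ∀ a b c d → (a ℤ.+ b) ℤ.+ (c ℤ.+ d) ≡ (a ℤ.+ c) ℤ.+ (b ℤ.+ d)
  eq = ring

infixr 4 _∙_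
_∙_ : {f g h : Seq} → f ≗ g → g ≗ h → f ≗ h
(p ∙ q) i = trans (p i) (q i)

sym≗ : {f g : Seq} → f ≗ g → g ≗ f
sym≗ p i = sym (p i)

refl≗ : {f : Seq} → f ≗ f
refl≗ _ = refl

record Linear (F : Seq → Seq) : Set where
  field
    resp : ∀ {f g} → f ≗ g → F f ≗ F g
    add  : ∀ f g → F (f ⊞ g) ≗ F f ⊞ F g
    scl  : ∀ z f → F (z ⊙ f) ≗ z ⊙ F f

  null : F 0S ≗ 0S
  null = resp (λ _ → refl) ∙ scl (+ 0) 0S

open Linear

id-linear : Linear id
id-linear .resp p  = p
id-linear .add f g = refl≗
id-linear .scl z f = refl≗

⊙-linear : ∀ z → Linear (z ⊙_)
⊙-linear z .resp p      = ⊙-cong z p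
⊙-linear z .add f g i   = ℤ.*-distribˡ-+ z (f i) (g i)
⊙-linear z .scl w f i   = eq z w (f i)
  where
  eq : ∀ a b c → a ℤ.* (b ℤ.* c) ≡ b ℤ.* (a ℤ.* c)
  eq = ring

shift-linear : Linear shift
shift-linear .resp p zero        = refl
shift-linear .resp p (suc i)     = p i
shift-linear .add f g zero       = refl
shift-linear .add f g (suc i)    = refl
shift-linear .scl z f zero       = sym (ℤ.*-zeroʳ z)
shift-linear .scl z f (suc i)    = refl

∘-linear : ∀ {F G} → Linear F → Linear G → Linear (F ∘ G)
∘-linear l k .resp p  = resp l (resp k p)
∘-linear l k .add f g = resp l (add k f g) ∙ add l _ _
∘-linear l k .scl z f = resp l (scl k z f) ∙ scl l z _

⊞-linear : ∀ {F G} → Linear F → Linear G → Linear (λ f → F f ⊞ G f)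
⊞-linear l k .resp p  = ⊞-cong (resp l p) (resp k p)
⊞-linear {F} {G} l k .add f g =
  ⊞-cong (add l f g) (add k f g) ∙ ⊞-interchange (F f) (F g) (G f) (G g)
⊞-linear {F} {G} l k .scl z f =
  ⊞-cong (scl l z f) (scl k z f) ∙ sym≗ (add (⊙-linear z) (F f) (G f))

op-linear : ∀ a b → Linear (op a b)
op-linear a b = ⊞-linear (⊙-linear a) (∘-linear (⊙-linear b) shift-linear)

iter-linear : ∀ {F} → Linear F → ∀ n → Linear (iter F n)
iter-linear l zero    = id-linear
iter-linear l (suc n) = ∘-linear l (iter-linear l n)

Commute : (Seq → Seq) → (Seq → Seq) → Set
Commute F G = ∀ f → F (G f) ≗ G (F f)

op-commute : ∀ {F} → Linear F → Commute F shift → ∀ a b → Commute F (op a b)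
op-commute l c a b f =
  add l _ _ ∙ ⊞-cong (scl l a f) (scl l b (shift f) ∙ ⊙-cong b (c f))

shift-op-commute : ∀ a b → Commute (op a b) shift
shift-op-commute a b f = sym≗ (op-commute shift-linear (λ _ → refl≗) a b f)

ops-commute : ∀ a b c d → Commute (op a b) (op c d)
ops-commute a b = op-commute (op-linear a b) (shift-op-commute a b)

iter-commute : ∀ {F G} → Linear F → Linear G → Commute F G → ∀ n → Commute F (iter G n)
iter-commute l k c zero    f = refl≗
iter-commute l k c (suc n) f = c _ ∙ resp k (iter-commute l k c n f)

-- Binomial sums: Bin F n g = Σ_s C(n,s) F^{n-s}(g s).

Bin : (Seq → Seq) → ℕ → (ℕ → Seq) → Seq
Bin F zero    g = g 0
Bin F (suc n) g = Bin F n (F ∘ g) ⊞ Bin F n (g ∘ suc)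

module _ {F : Seq → Seq} (l : Linear F) where

  Bin-cong : ∀ n {g h} → (∀ s → g s ≗ h s) → Bin F n g ≗ Bin F n h
  Bin-cong zero    p = p 0
  Bin-cong (suc n) p = ⊞-cong (Bin-cong n (resp l ∘ p)) (Bin-cong n (p ∘ suc))

  Bin-add : ∀ n g h → Bin F n (λ s → g s ⊞ h s) ≗ Bin F n g ⊞ Bin F n h
  Bin-add zero    g h = refl≗
  Bin-add (suc n) g h =
    ⊞-cong (Bin-cong n (λ s → add l (g s) (h s)) ∙ Bin-add n (F ∘ g) (F ∘ h))
           (Bin-add n (g ∘ suc) (h ∘ suc))
    ∙ ⊞-interchange (Bin F n (F ∘ g)) (Bin F n (F ∘ h)) (Bin F n (g ∘ suc)) (Bin F n (h ∘ suc))

  Bin-commute : ∀ {G} → Linear G → Commute G F → ∀ n g → G (Bin F n g) ≗ Bin F n (G ∘ g)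
  Bin-commute k c zero    g = refl≗
  Bin-commute {G} k c (suc n) g =
    add k _ _
    ∙ ⊞-cong (Bin-commute k c n (F ∘ g) ∙ Bin-cong n (λ s → c (g s)))
             (Bin-commute k c n (g ∘ suc))

-- Multiplication by 1 - t and by t - 1.
L L⁻ : Seq → Seq
L  = op (+ 1) (- + 1)
L⁻ = op (- + 1) (+ 1)

-- Taking a sign out of each of the n - s factors 1 - t turns (-1)^s into (-1)^n.
Bin-sign : ∀ n g → Bin L n (λ s → sign s ⊙ g s) ≗ sign n ⊙ Bin L⁻ n g
Bin-sign zero    g = refl≗
Bin-sign (suc n) g =
  ⊞-cong (Bin-cong ll n (λ s → scl ll (sign s) (g s) ∙ λ i → eq₁ (sign s) (g s i) (shift (g s) i))
          ∙ Bin-sign n (λ s → (- + 1) ⊙ L⁻ (g s)))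
         (Bin-cong ll n (λ s i → eq₂ (sign s) (g (suc s) i))
          ∙ Bin-sign n (λ s → (- + 1) ⊙ g (suc s)))
  ∙ ⊞-cong (⊙-cong (sign n) (neg (L⁻ ∘ g))) (⊙-cong (sign n) (neg (g ∘ suc)))
  ∙ λ i → eq₃ (sign n) (Bin L⁻ n (L⁻ ∘ g) i) (Bin L⁻ n (g ∘ suc) i)
  where
  ll = op-linear (+ 1) (- + 1)
  ll⁻ = op-linear (- + 1) (+ 1)
  neg : ∀ h → Bin L⁻ n (λ s → (- + 1) ⊙ h s) ≗ (- + 1) ⊙ Bin L⁻ n h
  neg h = sym≗ (Bin-commute ll⁻ (⊙-linear (- + 1)) (λ f → sym≗ (scl ll⁻ (- + 1) f)) n h)
  eq₁ : ∀ a x y → a ℤ.* (+ 1 ℤ.* x ℤ.+ - + 1 ℤ.* y) ≡ a ℤ.* (- + 1 ℤ.* (- + 1 ℤ.* x ℤ.+ + 1 ℤ.* y))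
  eq₁ = ring
  eq₂ : ∀ a x → - a ℤ.* x ≡ a ℤ.* (- + 1 ℤ.* x)
  eq₂ = ring
  eq₃ : ∀ a x y → a ℤ.* (- + 1 ℤ.* x) ℤ.+ a ℤ.* (- + 1 ℤ.* y) ≡ - a ℤ.* (x ℤ.+ y)
  eq₃ = ring

-- Umbrally, (t - 1) + (1 + E) = t + E, where E raises the index.
Bin-compose : ∀ n g → Bin L⁻ n (λ s → Bin id s g) ≗ Bin shift n g
Bin-compose zero    g = refl≗
Bin-compose (suc n) g =
  ⊞-cong (Bin-cong ll⁻ n (λ s → Bin-commute id-linear ll⁻ (λ _ → refl≗) s g)
          ∙ Bin-compose n (L⁻ ∘ g))
         (Bin-add ll⁻ n (λ s → Bin id s g) (λ s → Bin id s (g ∘ suc))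
          ∙ ⊞-cong (Bin-compose n g) (Bin-compose n (g ∘ suc)))
  ∙ (λ i → sym (ℤ.+-assoc (Bin shift n (L⁻ ∘ g) i) _ _))
  ∙ ⊞-cong (sym≗ (Bin-add shift-linear n (L⁻ ∘ g) g)
            ∙ Bin-cong shift-linear n (λ s i → eq (g s i) (shift (g s) i)))
           refl≗
  where
  ll⁻ = op-linear (- + 1) (+ 1)
  eq : ∀ x y → (- + 1 ℤ.* x ℤ.+ + 1 ℤ.* y) ℤ.+ x ≡ y
  eq = ring

-- Here E acts on `g` as multiplication by 1 + t, so the umbral t + E is multiplication by 1 + 2t.
Bin-geometric : ∀ n g → (∀ s → g (suc s) ≗ op (+ 1) (+ 1) (g s)) →
                Bin shift n g ≗ iter (op (+ 1) (+ 2)) n (g 0)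
Bin-geometric zero    g p = refl≗
Bin-geometric (suc n) g p =
  ⊞-cong (Bin-geometric n (shift ∘ g)
            (λ s → resp shift-linear (p s) ∙ sym≗ (shift-op-commute (+ 1) (+ 1) (g s))))
         (Bin-geometric n (g ∘ suc) (p ∘ suc))
  ∙ sym≗ (add ll (shift (g 0)) (g 1))
  ∙ resp ll (⊞-cong {f = shift (g 0)} refl≗ (p 0) ∙ λ i → eq (g 0 i) (shift (g 0) i))
  ∙ λ i → cong (λ f → f i) (sym (iter-inner (op (+ 1) (+ 2)) n (g 0)))
  where
  ll = iter-linear (op-linear (+ 1) (+ 2)) n
  eq : ∀ x y → y ℤ.+ (+ 1 ℤ.* x ℤ.+ + 1 ℤ.* y) ≡ + 1 ℤ.* x ℤ.+ + 2 ℤ.* y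
  eq = ring

-- The term t^{n-s} g_s contributes to degree i only through degree i - (n - s) of g_s, and twice
-- that is at most s when 2i ≤ n. The slack `c` grows by one in both recursive calls: a shift lowers
-- the degree read, and `suc` raises the index.
Bin-agree : ∀ n c g h → (∀ s i → 2 ℕ.* i ≤ c ℕ.+ s → g s i ≡ h s i) →
            ∀ i → 2 ℕ.* i ≤ c ℕ.+ n → Bin shift n g i ≡ Bin shift n h i
Bin-agree zero    c g h p i q = p 0 i q
Bin-agree (suc n) c g h p i q =
  cong₂ ℤ._+_ (Bin-agree n (suc c) (shift ∘ g) (shift ∘ h) shifted i q′)
              (Bin-agree n (suc c) (g ∘ suc) (h ∘ suc) (λ s j r → p (suc s) j (subst (2 ℕ.* j ≤_) (sym (ℕ.+-suc c s)) r)) i q′)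
  where
  q′ = subst (2 ℕ.* i ≤_) (ℕ.+-suc c n) q
  shifted : ∀ s j → 2 ℕ.* j ≤ suc c ℕ.+ s → shift (g s) j ≡ shift (h s) j
  shifted s zero    r = refl
  shifted s (suc j) r = p s j (ℕ.≤-trans (ℕ.n≤1+n _) (ℕ.≤-pred (subst (_≤ suc c ℕ.+ s) (cong suc (ℕ.+-suc j (j ℕ.+ 0))) r)))

Bin-zero : ∀ n g i → (∀ s → s ≤ n → g s i ≡ + 0) → Bin id n g i ≡ + 0
Bin-zero zero    g i p = p 0 z≤n
Bin-zero (suc n) g i p =
  cong₂ ℤ._+_ (Bin-zero n g i (λ s q → p s (ℕ.m≤n⇒m≤1+n q)))
              (Bin-zero n (g ∘ suc) i (λ s q → p (suc s) (s≤s q)))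

-- The ballot polynomials (1-t)(1+t)^s and their truncations R_s.

ballotS : ℕ → Seq
ballotS s = iter (op (+ 1) (+ 1)) s (L (tpow 0))

truncS : ℕ → Seq
truncS s i = if 2 ℕ.* i ≤ᵇ s then ballotS s i else + 0

-- The coefficient sequence of Q for the thagomizer matroid with n spikes.
qS : ℕ → Seq
qS n = Bin id n truncS

≤ᵇ-true : ∀ {m n} → m ≤ n → (m ≤ᵇ n) ≡ true
≤ᵇ-true {m} {n} p with m ≤ᵇ n | ℕ.≤⇒≤ᵇ p
... | true | _ = refl

≤ᵇ-false : ∀ {m n} → n < m → (m ≤ᵇ n) ≡ false
≤ᵇ-false {m} {n} p with m ≤ᵇ n in e
... | false = refl
... | true  = contradiction (ℕ.≤ᵇ⇒≤ m n (subst T (sym e) _)) (ℕ.<⇒≱ p)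

truncS-low : ∀ s i → 2 ℕ.* i ≤ s → truncS s i ≡ ballotS s i
truncS-low s i p rewrite ≤ᵇ-true p = refl

truncS-high : ∀ s i → s < 2 ℕ.* i → truncS s i ≡ + 0
truncS-high s i p rewrite ≤ᵇ-false p = refl

qS-high : ∀ n i → n < 2 ℕ.* i → qS n i ≡ + 0
qS-high n i p = Bin-zero n truncS i (λ s q → truncS-high s i (ℕ.≤-<-trans q p))

-- The low half of the defining identity. The bound `2 * i ≤ n` is exactly what `Bin-agree` needs to
-- trade the truncated ballot polynomials for the full ones, which are geometric in s.
qS-identity : ∀ n i → 2 ℕ.* i ≤ n → Bin L⁻ n qS i ≡ L (iter (op (+ 1) (+ 2)) n (tpow 0)) i
qS-identity n i p = begin
  Bin L⁻ n qS i                            ≡⟨ Bin-compose n truncS i ⟩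
  Bin shift n truncS i                     ≡⟨ Bin-agree n 0 truncS ballotS truncS-low i p ⟩
  Bin shift n ballotS i                    ≡⟨ Bin-geometric n ballotS (λ _ → refl≗) i ⟩
  iter (op (+ 1) (+ 2)) n (L (tpow 0)) i   ≡⟨ iter-commute (op-linear (+ 1) (- + 1)) (op-linear (+ 1) (+ 2)) (ops-commute (+ 1) (- + 1) (+ 1) (+ 2)) n (tpow 0) i ⟨
  L (iter (op (+ 1) (+ 2)) n (tpow 0)) i   ∎
  where open ≡-Reasoning

-- Log-concavity of qS

-- The consecutive ratios of `a` decrease, stated without division. Taking all pairs `i ≤ j`, not
-- only neighbours, controls internal zeros: 1, 0, 0, 1 is log-concave, but its product with 1 + x
-- is not.
PF₂ : (ℕ → ℕ) → Set
PF₂ a = ∀ i j → i ≤ j → a i ℕ.* a (suc j) ≤ a (suc i) ℕ.* a j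

PF₂-cong : ∀ {a b} → a ≗ b → PF₂ a → PF₂ b
PF₂-cong p h i j q rewrite sym (p i) | sym (p j) | sym (p (suc i)) | sym (p (suc j)) = h i j q

-- Multiplication by 1 + x.
up : (ℕ → ℕ) → ℕ → ℕ
up a zero    = a 0
up a (suc d) = a (suc d) ℕ.+ a d

up-cong : ∀ {a b} → a ≗ b → up a ≗ up b
up-cong p zero    = p 0
up-cong p (suc d) = cong₂ ℕ._+_ (p (suc d)) (p d)

up-PF₂ : ∀ {a} → PF₂ a → PF₂ (up a)
up-PF₂ {a} h zero zero    q = ℕ.≤-reflexive (ℕ.*-comm (a 0) _)
up-PF₂ {a} h zero (suc j) q = begin
  a 0 ℕ.* (a (suc (suc j)) ℕ.+ a (suc j))                  ≡⟨ ℕ.*-distribˡ-+ (a 0) _ _ ⟩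
  a 0 ℕ.* a (suc (suc j)) ℕ.+ a 0 ℕ.* a (suc j)            ≤⟨ ℕ.+-monoˡ-≤ _ (h 0 (suc j) z≤n) ⟩
  a 1 ℕ.* a (suc j) ℕ.+ a 0 ℕ.* a (suc j)                  ≡⟨ ℕ.*-distribʳ-+ (a (suc j)) (a 1) (a 0) ⟨
  (a 1 ℕ.+ a 0) ℕ.* a (suc j)                              ≤⟨ ℕ.*-monoʳ-≤ (a 1 ℕ.+ a 0) (ℕ.m≤m+n _ (a j)) ⟩
  (a 1 ℕ.+ a 0) ℕ.* (a (suc j) ℕ.+ a j)                    ∎
  where open ℕ.≤-Reasoning
up-PF₂ {a} h (suc i) (suc j) (s≤s q) = begin
  (a (suc i) ℕ.+ a i) ℕ.* (a (suc (suc j)) ℕ.+ a (suc j))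
    ≡⟨ expand (a (suc i)) (a i) _ _ ⟩
  (a (suc i) ℕ.* a (suc (suc j)) ℕ.+ a i ℕ.* a (suc j)) ℕ.+ (a (suc i) ℕ.* a (suc j) ℕ.+ a i ℕ.* a (suc (suc j)))
    ≤⟨ ℕ.+-mono-≤ (ℕ.+-mono-≤ (h (suc i) (suc j) (s≤s q)) (h i j q)) (ℕ.+-monoʳ-≤ (a (suc i) ℕ.* a (suc j)) (outer (ℕ.m≤n⇒m<n∨m≡n q))) ⟩
  (a (suc (suc i)) ℕ.* a (suc j) ℕ.+ a (suc i) ℕ.* a j) ℕ.+ (a (suc i) ℕ.* a (suc j) ℕ.+ a (suc (suc i)) ℕ.* a j)
    ≡⟨ collect (a (suc (suc i))) (a (suc i)) _ _ ⟩
  (a (suc (suc i)) ℕ.+ a (suc i)) ℕ.* (a (suc j) ℕ.+ a j) ∎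
  where
  open ℕ.≤-Reasoning
  expand : ∀ x y z w → (x ℕ.+ y) ℕ.* (z ℕ.+ w) ≡ (x ℕ.* z ℕ.+ y ℕ.* w) ℕ.+ (x ℕ.* w ℕ.+ y ℕ.* z)
  expand = semiring
  collect : ∀ x y z w → (x ℕ.* z ℕ.+ y ℕ.* w) ℕ.+ (y ℕ.* z ℕ.+ x ℕ.* w) ≡ (x ℕ.+ y) ℕ.* (z ℕ.+ w)
  collect = semiring
  -- The chain passes through `a (suc i) * a (suc j)`, and its second link needs `suc i ≤ j`; for
  -- `i = j` the two sides coincide.
  outer : i < j ⊎ i ≡ j → a i ℕ.* a (suc (suc j)) ≤ a (suc (suc i)) ℕ.* a j
  outer (inj₁ i<j)  = ℕ.≤-trans (h i (suc j) (ℕ.m≤n⇒m≤1+n q)) (h (suc i) j i<j)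
  outer (inj₂ refl) = ℕ.≤-reflexive (ℕ.*-comm (a i) _)

-- Termwise, after expanding (1 + x)a and (1 + x)²a.
up-diagonal : ∀ {a} → PF₂ a → ∀ d →
  a d ℕ.* up (up a) (4 ℕ.+ d) ≤ up a (2 ℕ.+ d) ℕ.* up a (2 ℕ.+ d)
up-diagonal {a} h d = begin
  a d ℕ.* ((a₄ ℕ.+ a₃) ℕ.+ (a₃ ℕ.+ a₂))
    ≡⟨ expand (a d) a₂ a₃ a₄ ⟩
  a d ℕ.* a₄ ℕ.+ (a d ℕ.* a₃ ℕ.+ a d ℕ.* a₃) ℕ.+ a d ℕ.* a₂
    ≤⟨ ℕ.+-mono-≤ (ℕ.+-mono-≤ s₄ (ℕ.+-mono-≤ s₃ s₃)) s₂ ⟩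
  a₂ ℕ.* a₂ ℕ.+ (a₁ ℕ.* a₂ ℕ.+ a₁ ℕ.* a₂) ℕ.+ a₁ ℕ.* a₁
    ≡⟨ collect a₁ a₂ ⟩
  (a₂ ℕ.+ a₁) ℕ.* (a₂ ℕ.+ a₁) ∎
  where
  open ℕ.≤-Reasoning
  a₁ = a (1 ℕ.+ d)
  a₂ = a (2 ℕ.+ d)
  a₃ = a (3 ℕ.+ d)
  a₄ = a (4 ℕ.+ d)
  expand : ∀ x y z w → x ℕ.* ((w ℕ.+ z) ℕ.+ (z ℕ.+ y)) ≡ x ℕ.* w ℕ.+ (x ℕ.* z ℕ.+ x ℕ.* z) ℕ.+ x ℕ.* y
  expand = semiring
  collect : ∀ x y → y ℕ.* y ℕ.+ (x ℕ.* y ℕ.+ x ℕ.* y) ℕ.+ x ℕ.* x ≡ (y ℕ.+ x) ℕ.* (y ℕ.+ x)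
  collect = semiring
  s₂ : a d ℕ.* a₂ ≤ a₁ ℕ.* a₁
  s₂ = h d (suc d) (ℕ.n≤1+n d)
  s₃ : a d ℕ.* a₃ ≤ a₁ ℕ.* a₂
  s₃ = h d (2 ℕ.+ d) (ℕ.m≤n+m d 2)
  s₄ : a d ℕ.* a₄ ≤ a₂ ℕ.* a₂
  s₄ = ℕ.≤-trans (h d (3 ℕ.+ d) (ℕ.m≤n+m d 3)) (h (suc d) (2 ℕ.+ d) (ℕ.n≤1+n _))

-- Binomial coefficients and the rows of (1+x)^N / (1-x)².

δ : ℕ → ℕ
δ zero    = 1
δ (suc _) = 0

bin : ℕ → ℕ → ℕ
bin zero    = δ
bin (suc n) = up (bin n)

bin-PF₂ : ∀ n → PF₂ (bin n)
bin-PF₂ zero    i j q = ℕ.≤-trans (ℕ.≤-reflexive (ℕ.*-zeroʳ (δ i))) z≤n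
bin-PF₂ (suc n) = up-PF₂ (bin-PF₂ n)

bin-zero : ∀ {n k} → n < k → bin n k ≡ 0
bin-zero {zero}  {suc k} _       = refl
bin-zero {suc n} {suc k} (s≤s p) = cong₂ ℕ._+_ (bin-zero (ℕ.m≤n⇒m≤1+n p)) (bin-zero p)

bin-0 : ∀ n → bin n 0 ≡ 1
bin-0 zero    = refl
bin-0 (suc n) = bin-0 n

bin-n : ∀ n → bin n n ≡ 1
bin-n zero    = refl
bin-n (suc n) = cong₂ ℕ._+_ (bin-zero (ℕ.n<1+n n)) (bin-n n)

-- Pascal's rule with denominators cleared: the two summands have weights b+1 and a+1, which add up
-- to the new factor of the factorial.
bin-! : ∀ a b → bin (a ℕ.+ b) a ℕ.* (a ! ℕ.* b !) ≡ (a ℕ.+ b) !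
bin-! zero    b rewrite bin-0 b = trans (ℕ.+-identityʳ _) (ℕ.+-identityʳ _)
bin-! (suc a) zero rewrite ℕ.+-identityʳ a | bin-n (suc a) =
  trans (ℕ.+-identityʳ _) (ℕ.*-identityʳ _)
bin-! (suc a) (suc b) = begin
  (X ℕ.+ Y) ℕ.* ((suc a ℕ.* a !) ℕ.* (suc b ℕ.* b !))
    ≡⟨ regroup X Y a b (a !) (b !) ⟩
  suc b ℕ.* (X ℕ.* ((suc a ℕ.* a !) ℕ.* b !)) ℕ.+ suc a ℕ.* (Y ℕ.* (a ! ℕ.* (suc b ℕ.* b !)))
    ≡⟨ cong₂ (λ x y → suc b ℕ.* x ℕ.+ suc a ℕ.* y) ih (bin-! a (suc b)) ⟩
  suc b ℕ.* (a ℕ.+ suc b) ! ℕ.+ suc a ℕ.* (a ℕ.+ suc b) !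
    ≡⟨ factor a b ((a ℕ.+ suc b) !) ⟩
  suc (a ℕ.+ suc b) ℕ.* (a ℕ.+ suc b) ! ∎
  where
  open ≡-Reasoning
  X = bin (a ℕ.+ suc b) (suc a)
  Y = bin (a ℕ.+ suc b) a
  ih : X ℕ.* ((suc a ℕ.* a !) ℕ.* b !) ≡ (a ℕ.+ suc b) !
  ih = subst (λ m → bin m (suc a) ℕ.* ((suc a ℕ.* a !) ℕ.* b !) ≡ m !) (sym (ℕ.+-suc a b)) (bin-! (suc a) b)
  regroup : ∀ x y p q f g → (x ℕ.+ y) ℕ.* ((suc p ℕ.* f) ℕ.* (suc q ℕ.* g)) ≡
            suc q ℕ.* (x ℕ.* ((suc p ℕ.* f) ℕ.* g)) ℕ.+ suc p ℕ.* (y ℕ.* (f ℕ.* (suc q ℕ.* g)))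
  regroup = semiring
  factor : ∀ p q f → suc q ℕ.* f ℕ.+ suc p ℕ.* f ≡ suc (p ℕ.+ suc q) ℕ.* f
  factor = semiring

-- Prefix sums, that is, multiplication by 1/(1-x).
pre : (ℕ → ℕ) → ℕ → ℕ
pre a zero    = a 0
pre a (suc d) = pre a d ℕ.+ a (suc d)

pre-cong : ∀ {a b} d → (∀ j → j ≤ d → a j ≡ b j) → pre a d ≡ pre b d
pre-cong zero    p = p 0 z≤n
pre-cong (suc d) p = cong₂ ℕ._+_ (pre-cong d (λ j q → p j (ℕ.m≤n⇒m≤1+n q))) (p (suc d) ℕ.≤-refl)

pre-add : ∀ a b d → pre (λ j → a j ℕ.+ b j) d ≡ pre a d ℕ.+ pre b d
pre-add a b zero    = refl
pre-add a b (suc d) = trans (cong₂ ℕ._+_ (pre-add a b d) refl) (eq (pre a d) (pre b d) _ _)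
  where
  eq : ∀ x y z w → (x ℕ.+ y) ℕ.+ (z ℕ.+ w) ≡ (x ℕ.+ z) ℕ.+ (y ℕ.+ w)
  eq = semiring

pre-up : ∀ a → pre (up a) ≗ up (pre a)
pre-up a zero          = refl
pre-up a (suc zero)    = eq (a 0) (a 1)
  where
  eq : ∀ x y → x ℕ.+ (y ℕ.+ x) ≡ (x ℕ.+ y) ℕ.+ x
  eq = semiring
pre-up a (suc (suc d)) = trans (cong (ℕ._+ (a (2 ℕ.+ d) ℕ.+ a (1 ℕ.+ d))) (pre-up a (suc d))) (eq (pre a d) (a (suc d)) _)
  where
  eq : ∀ x y z → ((x ℕ.+ y) ℕ.+ x) ℕ.+ (z ℕ.+ y) ≡ ((x ℕ.+ y) ℕ.+ z) ℕ.+ (x ℕ.+ y)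
  eq = semiring

-- The weights 1, 2, 3, ... are the coefficients of 1/(1-x)². The weighted form is the one in which
-- the ballot numbers deliver the sum.
pre-pre : ∀ a d → pre (pre a) d ≡ pre (λ j → suc (d ∸ j) ℕ.* a j) d
pre-pre a zero    = sym (ℕ.+-identityʳ (a 0))
pre-pre a (suc d) = begin
  pre (pre a) d ℕ.+ (pre a d ℕ.+ a (suc d))
    ≡⟨ cong₂ ℕ._+_ (pre-pre a d) refl ⟩
  pre (λ j → suc (d ∸ j) ℕ.* a j) d ℕ.+ (pre a d ℕ.+ a (suc d))
    ≡⟨ eq (pre (λ j → suc (d ∸ j) ℕ.* a j) d) (pre a d) (a (suc d)) ⟩
  (pre a d ℕ.+ pre (λ j → suc (d ∸ j) ℕ.* a j) d) ℕ.+ 1 ℕ.* a (suc d)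
    ≡⟨ cong₂ ℕ._+_ (sym (pre-add a _ d)) (cong (λ x → suc x ℕ.* a (suc d)) (sym (ℕ.n∸n≡0 (suc d)))) ⟩
  pre (λ j → a j ℕ.+ suc (d ∸ j) ℕ.* a j) d ℕ.+ suc (suc d ∸ suc d) ℕ.* a (suc d)
    ≡⟨ cong₂ ℕ._+_ (pre-cong d (λ j q → cong (λ x → suc x ℕ.* a j) (sym (ℕ.+-∸-assoc 1 q)))) refl ⟩
  pre (λ j → suc (suc d ∸ j) ℕ.* a j) d ℕ.+ suc (suc d ∸ suc d) ℕ.* a (suc d) ∎
  where
  open ≡-Reasoning
  eq : ∀ x y z → x ℕ.+ (y ℕ.+ z) ≡ (y ℕ.+ x) ℕ.+ 1 ℕ.* z
  eq = semiring

-- Coefficient of x^d in (1 + x)^N / (1 - x)².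
dbl : ℕ → ℕ → ℕ
dbl N = pre (pre (bin N))

dbl-suc : ∀ N → up (dbl N) ≗ dbl (suc N)
dbl-suc N d = sym (trans (pre-cong d (λ j _ → pre-up (bin N) j)) (pre-up (pre (bin N)) d))

dbl-0 : ∀ d → suc d ≡ dbl 0 d
dbl-0 zero    = refl
dbl-0 (suc d) = trans (ℕ.+-comm 1 (suc d)) (cong₂ ℕ._+_ (dbl-0 d) (sym (one (suc d))))
  where
  one : ∀ d → pre δ d ≡ 1
  one zero    = refl
  one (suc d) = trans (ℕ.+-identityʳ _) (one d)

dbl-PF₂ : ∀ N → PF₂ (dbl N)
-- For the sequence 1, 2, 3, ... the two products differ by exactly j - i.
dbl-PF₂ zero    = PF₂-cong dbl-0 λ i j q → ℕ.≤-trans (ℕ.≤-reflexive (expand i j)) (ℕ.≤-trans (ℕ.+-monoʳ-≤ (2 ℕ.+ j ℕ.+ i ℕ.+ i ℕ.* j) q) (ℕ.≤-reflexive (collect i j)))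
  where
  expand : ∀ i j → (1 ℕ.+ i) ℕ.* (2 ℕ.+ j) ≡ (2 ℕ.+ j ℕ.+ i ℕ.+ i ℕ.* j) ℕ.+ i
  expand = semiring
  collect : ∀ i j → (2 ℕ.+ j ℕ.+ i ℕ.+ i ℕ.* j) ℕ.+ j ≡ (2 ℕ.+ i) ℕ.* (1 ℕ.+ j)
  collect = semiring
dbl-PF₂ (suc N) = PF₂-cong (dbl-suc N) (up-PF₂ (dbl-PF₂ N))

dbl-diagonal : ∀ N d → dbl N d ℕ.* dbl (2 ℕ.+ N) (4 ℕ.+ d) ≤ dbl (suc N) (2 ℕ.+ d) ℕ.* dbl (suc N) (2 ℕ.+ d)
dbl-diagonal N d
  rewrite sym (dbl-suc (suc N) (4 ℕ.+ d)) | sym (up-cong (dbl-suc N) (4 ℕ.+ d)) | sym (dbl-suc N (2 ℕ.+ d))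
  = up-diagonal {dbl N} (dbl-PF₂ N) d

-- Integer sums and the closed form of the coefficients.

preℤ : (ℕ → ℤ) → ℕ → ℤ
preℤ a zero    = a 0
preℤ a (suc d) = preℤ a d ℤ.+ a (suc d)

preℤ-cong : ∀ {a b} d → (∀ j → j ≤ d → a j ≡ b j) → preℤ a d ≡ preℤ b d
preℤ-cong zero    p = p 0 z≤n
preℤ-cong (suc d) p = cong₂ ℤ._+_ (preℤ-cong d (λ j q → p j (ℕ.m≤n⇒m≤1+n q))) (p (suc d) ℕ.≤-refl)

preℤ-add : ∀ a b d → preℤ (λ j → a j ℤ.+ b j) d ≡ preℤ a d ℤ.+ preℤ b d
preℤ-add a b zero    = refl
preℤ-add a b (suc d) = trans (cong₂ ℤ._+_ (preℤ-add a b d) refl) (eq (preℤ a d) (preℤ b d) _ _)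
  where
  eq : ∀ x y z w → (x ℤ.+ y) ℤ.+ (z ℤ.+ w) ≡ (x ℤ.+ z) ℤ.+ (y ℤ.+ w)
  eq = ring

preℤ-scale : ∀ z a d → z ℤ.* preℤ a d ≡ preℤ (λ j → z ℤ.* a j) d
preℤ-scale z a zero    = refl
preℤ-scale z a (suc d) = trans (ℤ.*-distribˡ-+ z _ _) (cong₂ ℤ._+_ (preℤ-scale z a d) refl)

preℤ-pos : ∀ a d → + pre a d ≡ preℤ (λ j → + a j) d
preℤ-pos a zero    = refl
preℤ-pos a (suc d) = trans (ℤ.pos-+ (pre a d) _) (cong₂ ℤ._+_ (preℤ-pos a d) refl)

preℤ-head : ∀ a d → preℤ a (suc d) ≡ a 0 ℤ.+ preℤ (a ∘ suc) d
preℤ-head a zero    = refl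
preℤ-head a (suc d) = trans (cong₂ ℤ._+_ (preℤ-head a d) refl) (ℤ.+-assoc (a 0) _ _)

preℤ-reverse : ∀ a n → preℤ a n ≡ preℤ (λ j → a (n ∸ j)) n
preℤ-reverse a zero    = refl
preℤ-reverse a (suc n) = begin
  preℤ a n ℤ.+ a (suc n)                       ≡⟨ ℤ.+-comm (preℤ a n) _ ⟩
  a (suc n) ℤ.+ preℤ a n                       ≡⟨ cong (λ x → a (suc n) ℤ.+ x) (preℤ-reverse a n) ⟩
  a (suc n) ℤ.+ preℤ (λ j → a (n ∸ j)) n       ≡⟨ preℤ-head (λ j → a (suc n ∸ j)) n ⟨
  preℤ (λ j → a (suc n ∸ j)) (suc n)           ∎
  where open ≡-Reasoning

preℤ-trim : ∀ a d e → (∀ j → d < j → j ≤ e ℕ.+ d → a j ≡ + 0) → preℤ a (e ℕ.+ d) ≡ preℤ a d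
preℤ-trim a d zero    p = refl
preℤ-trim a d (suc e) p rewrite p (suc (e ℕ.+ d)) (s≤s (ℕ.m≤n+m d e)) ℕ.≤-refl =
  trans (ℤ.+-identityʳ _) (preℤ-trim a d e (λ j q r → p j q (ℕ.m≤n⇒m≤1+n r)))

Bin-sum : ∀ n g i → Bin id n g i ≡ preℤ (λ s → + bin n s ℤ.* g s i) n
Bin-sum zero    g i = sym (ℤ.*-identityˡ (g 0 i))
Bin-sum (suc n) g i = begin
  Bin id n g i ℤ.+ Bin id n (g ∘ suc) i
    ≡⟨ cong₂ ℤ._+_ (Bin-sum n g i) (Bin-sum n (g ∘ suc) i) ⟩
  preℤ f n ℤ.+ preℤ f′ n
    -- A term at s = n + 1 is appended, zero because C(n,n+1) = 0; after splitting off s = 0, both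
    -- sums have the same range and Pascal's rule applies termwise.
    ≡⟨ cong (ℤ._+ preℤ f′ n) (preℤ-trim f n 1 top) ⟨
  preℤ f (suc n) ℤ.+ preℤ f′ n
    ≡⟨ cong (ℤ._+ preℤ f′ n) (preℤ-head f n) ⟩
  (f 0 ℤ.+ preℤ (f ∘ suc) n) ℤ.+ preℤ f′ n
    ≡⟨ ℤ.+-assoc (f 0) _ _ ⟩
  f 0 ℤ.+ (preℤ (f ∘ suc) n ℤ.+ preℤ f′ n)
    ≡⟨ cong (λ x → f 0 ℤ.+ x) (preℤ-add (f ∘ suc) f′ n) ⟨
  f 0 ℤ.+ preℤ (λ s → f (suc s) ℤ.+ f′ s) n
    ≡⟨ cong (λ x → f 0 ℤ.+ x) (preℤ-cong n (λ s _ → collect s)) ⟩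
  f 0 ℤ.+ preℤ (λ s → + bin (suc n) (suc s) ℤ.* g (suc s) i) n
    ≡⟨ preℤ-head (λ s → + bin (suc n) s ℤ.* g s i) n ⟨
  preℤ (λ s → + bin (suc n) s ℤ.* g s i) (suc n) ∎
  where
  open ≡-Reasoning
  f f′ : ℕ → ℤ
  f s  = + bin n s ℤ.* g s i
  f′ s = + bin n s ℤ.* g (suc s) i
  top : ∀ j → n < j → j ≤ suc n → f j ≡ + 0
  top j p _ rewrite bin-zero p = ℤ.*-zeroˡ (g j i)
  collect : ∀ s → f (suc s) ℤ.+ f′ s ≡ + bin (suc n) (suc s) ℤ.* g (suc s) i
  collect s = trans (sym (ℤ.*-distribʳ-+ (g (suc s) i) (+ bin n (suc s)) (+ bin n s)))
                    (cong (ℤ._* g (suc s) i) (sym (ℤ.pos-+ (bin n (suc s)) (bin n s))))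

binS : ℕ → Seq
binS n i = + bin n i

iter-binS : ∀ n → iter (op (+ 1) (+ 1)) n (tpow 0) ≗ binS n
iter-binS zero    zero    = refl
iter-binS zero    (suc i) = refl
iter-binS (suc n) i = trans (resp (op-linear (+ 1) (+ 1)) (iter-binS n) i) (step i)
  where
  step : op (+ 1) (+ 1) (binS n) ≗ binS (suc n)
  step zero    = eq (binS n 0)
    where
    eq : ∀ x → + 1 ℤ.* x ℤ.+ + 1 ℤ.* + 0 ≡ x
    eq = ring
  step (suc i) = trans (cong₂ ℤ._+_ (ℤ.*-identityˡ (binS n (suc i))) (ℤ.*-identityˡ (binS n i))) (sym (ℤ.pos-+ (bin n (suc i)) (bin n i)))

ballotS-binS : ∀ n → ballotS n ≗ L (binS n)
ballotS-binS n =
  sym≗ (iter-commute (op-linear (+ 1) (- + 1)) (op-linear (+ 1) (+ 1)) (ops-commute (+ 1) (- + 1) (+ 1) (+ 1)) n (tpow 0))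
  ∙ resp (op-linear (+ 1) (- + 1)) (iter-binS n)

-- The ballot number C(s,k) - C(s,k-1) = s! (h+1) / (k! (k+h+1)!) for s = 2k + h, with denominators
-- cleared; it is the hook length formula for the shape (k+h, k). The two binomials contribute
-- (k+h+1) s! and k s!, whence the factor h+1.
hook : ∀ k h → ballotS (k ℕ.+ (k ℕ.+ h)) k ℤ.* + (k ! ℕ.* (suc (k ℕ.+ h)) !) ≡ + ((k ℕ.+ (k ℕ.+ h)) ! ℕ.* suc h)
hook zero h = begin
  ballotS h 0 ℤ.* + (1 ℕ.* (suc h) !)                       ≡⟨ cong₂ ℤ._*_ (ballotS-binS h 0) refl ⟩
  (+ 1 ℤ.* + bin h 0 ℤ.+ - + 1 ℤ.* + 0) ℤ.* + (1 ℕ.* (suc h) !)   ≡⟨ cong (λ x → (+ 1 ℤ.* + x ℤ.+ - + 1 ℤ.* + 0) ℤ.* + (1 ℕ.* (suc h) !)) (bin-0 h) ⟩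
  + 1 ℤ.* + (1 ℕ.* (suc h) !)                               ≡⟨ ℤ.*-identityˡ (+ (1 ℕ.* (suc h) !)) ⟩
  + (1 ℕ.* (suc h) !)                                       ≡⟨ cong +_ (eq h (h !)) ⟩
  + (h ! ℕ.* suc h)                                         ∎
  where
  open ≡-Reasoning
  eq : ∀ h f → 1 ℕ.* (suc h ℕ.* f) ≡ f ℕ.* suc h
  eq = semiring
hook (suc k) h = begin
  ballotS s (suc k) ℤ.* + X                                       ≡⟨ cong (ℤ._* + X) (ballotS-binS s (suc k)) ⟩
  (+ 1 ℤ.* + A ℤ.+ - + 1 ℤ.* + B) ℤ.* + X                         ≡⟨ distrib (+ A) (+ B) (+ X) ⟩
  + A ℤ.* + X ℤ.- + B ℤ.* + X                                     ≡⟨ cong₂ ℤ._-_ (ℤ.pos-* A X) (ℤ.pos-* B X) ⟨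
  + (A ℕ.* X) ℤ.- + (B ℕ.* X)                                     ≡⟨ cong (λ x → + x ℤ.- + (B ℕ.* X)) difference ⟩
  + (B ℕ.* X ℕ.+ s ! ℕ.* suc h) ℤ.- + (B ℕ.* X)                   ≡⟨ cong (ℤ._- + (B ℕ.* X)) (ℤ.pos-+ (B ℕ.* X) _) ⟩
  (+ (B ℕ.* X) ℤ.+ + (s ! ℕ.* suc h)) ℤ.- + (B ℕ.* X)             ≡⟨ cancel (+ (B ℕ.* X)) (+ (s ! ℕ.* suc h)) ⟩
  + (s ! ℕ.* suc h)                                               ∎
  where
  open ≡-Reasoning
  s = suc k ℕ.+ (suc k ℕ.+ h)
  A = bin s (suc k)
  B = bin s k
  X = (suc k) ! ℕ.* (suc (suc k ℕ.+ h)) !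
  distrib : ∀ a b x → (+ 1 ℤ.* a ℤ.+ - + 1 ℤ.* b) ℤ.* x ≡ a ℤ.* x ℤ.- b ℤ.* x
  distrib = ring
  cancel : ∀ a b → (a ℤ.+ b) ℤ.- a ≡ b
  cancel = ring
  upper : A ℕ.* ((suc k) ! ℕ.* (suc k ℕ.+ h) !) ≡ s !
  upper = bin-! (suc k) (suc k ℕ.+ h)
  lower : B ℕ.* (k ! ℕ.* (suc (suc k ℕ.+ h)) !) ≡ s !
  lower = subst (λ m → bin m k ℕ.* (k ! ℕ.* (suc (suc k ℕ.+ h)) !) ≡ m !) (ℕ.+-suc k (suc k ℕ.+ h)) (bin-! k (suc (suc k ℕ.+ h)))
  pull : ∀ a f g p → a ℕ.* (f ℕ.* (p ℕ.* g)) ≡ p ℕ.* (a ℕ.* (f ℕ.* g))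
  pull = semiring
  pull′ : ∀ b f g k → b ℕ.* ((suc k ℕ.* f) ℕ.* g) ≡ suc k ℕ.* (b ℕ.* (f ℕ.* g))
  pull′ = semiring
  split : ∀ k h x → suc (suc k ℕ.+ h) ℕ.* x ≡ suc k ℕ.* x ℕ.+ x ℕ.* suc h
  split = semiring
  difference : A ℕ.* X ≡ B ℕ.* X ℕ.+ s ! ℕ.* suc h
  difference = begin
    A ℕ.* X                                               ≡⟨ pull A ((suc k) !) ((suc k ℕ.+ h) !) (suc (suc k ℕ.+ h)) ⟩
    suc (suc k ℕ.+ h) ℕ.* (A ℕ.* ((suc k) ! ℕ.* (suc k ℕ.+ h) !))   ≡⟨ cong (suc (suc k ℕ.+ h) ℕ.*_) upper ⟩
    suc (suc k ℕ.+ h) ℕ.* s !                             ≡⟨ split k h (s !) ⟩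
    suc k ℕ.* s ! ℕ.+ s ! ℕ.* suc h                       ≡⟨ cong (λ x → suc k ℕ.* x ℕ.+ s ! ℕ.* suc h) lower ⟨
    suc k ℕ.* (B ℕ.* (k ! ℕ.* (suc (suc k ℕ.+ h)) !)) ℕ.+ s ! ℕ.* suc h   ≡⟨ cong (ℕ._+ s ! ℕ.* suc h) (pull′ B (k !) ((suc (suc k ℕ.+ h)) !) k) ⟨
    B ℕ.* X ℕ.+ s ! ℕ.* suc h                             ∎

-- Both sides are (n+1)! (h+1) / (j! k! (k+h+1)!), where n = s + j and s = 2k + h.
term : ∀ k h j → let s = k ℕ.+ (k ℕ.+ h); n = s ℕ.+ j in
  + suc n ℤ.* (+ bin n s ℤ.* ballotS s k) ≡
  + bin (suc n) k ℤ.* + (suc h ℕ.* bin (suc (k ℕ.+ (h ℕ.+ j))) j)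
term k h j = ℤ.*-cancelʳ-≡ _ _ (+ C) ⦃ nz ⦄ (trans lhs (sym rhs))
  where
  open ≡-Reasoning
  s = k ℕ.+ (k ℕ.+ h)
  n = s ℕ.+ j
  l = suc (k ℕ.+ h)
  N = suc (k ℕ.+ (h ℕ.+ j))
  C = (s ! ℕ.* j !) ℕ.* (k ! ℕ.* l !)
  nz : ℤ.NonZero (+ C)
  nz = ℕ.m*n≢0 (s ! ℕ.* j !) (k ! ℕ.* l !) ⦃ ℕ.m*n≢0 (s !) (j !) ⦃ ℕ._!≢0 s ⦄ ⦃ ℕ._!≢0 j ⦄ ⦄ ⦃ ℕ.m*n≢0 (k !) (l !) ⦃ ℕ._!≢0 k ⦄ ⦃ ℕ._!≢0 l ⦄ ⦄
  target = (suc n) ! ℕ.* (s ! ℕ.* suc h)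
  grp₁ : ∀ m a b c d → (m ℤ.* (a ℤ.* b)) ℤ.* (c ℤ.* d) ≡ (m ℤ.* (a ℤ.* c)) ℤ.* (b ℤ.* d)
  grp₁ = ring
  lhs : (+ suc n ℤ.* (+ bin n s ℤ.* ballotS s k)) ℤ.* + C ≡ + target
  lhs = begin
    (+ suc n ℤ.* (+ bin n s ℤ.* ballotS s k)) ℤ.* + C
      ≡⟨ cong ((+ suc n ℤ.* (+ bin n s ℤ.* ballotS s k)) ℤ.*_) (ℤ.pos-* (s ! ℕ.* j !) (k ! ℕ.* l !)) ⟩
    (+ suc n ℤ.* (+ bin n s ℤ.* ballotS s k)) ℤ.* (+ (s ! ℕ.* j !) ℤ.* + (k ! ℕ.* l !))
      ≡⟨ grp₁ (+ suc n) (+ bin n s) (ballotS s k) (+ (s ! ℕ.* j !)) (+ (k ! ℕ.* l !)) ⟩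
    (+ suc n ℤ.* (+ bin n s ℤ.* + (s ! ℕ.* j !))) ℤ.* (ballotS s k ℤ.* + (k ! ℕ.* l !))
      ≡⟨ cong₂ ℤ._*_ (cong (+ suc n ℤ.*_) (trans (sym (ℤ.pos-* (bin n s) _)) (cong +_ (bin-! s j)))) (hook k h) ⟩
    (+ suc n ℤ.* + (n !)) ℤ.* + (s ! ℕ.* suc h)
      ≡⟨ cong (ℤ._* + (s ! ℕ.* suc h)) (ℤ.pos-* (suc n) (n !)) ⟨
    + ((suc n) !) ℤ.* + (s ! ℕ.* suc h)
      ≡⟨ ℤ.pos-* ((suc n) !) (s ! ℕ.* suc h) ⟨
    + target ∎
  N≡ : N ≡ j ℕ.+ l
  N≡ = eq k h j
    where
    eq : ∀ k h j → suc (k ℕ.+ (h ℕ.+ j)) ≡ j ℕ.+ suc (k ℕ.+ h)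
    eq = semiring
  n≡ : suc n ≡ k ℕ.+ N
  n≡ = eq k h j
    where
    eq : ∀ k h j → suc ((k ℕ.+ (k ℕ.+ h)) ℕ.+ j) ≡ k ℕ.+ suc (k ℕ.+ (h ℕ.+ j))
    eq = semiring
  grp₂ : ∀ a h b s j k l → (a ℕ.* (suc h ℕ.* b)) ℕ.* ((s ℕ.* j) ℕ.* (k ℕ.* l)) ≡ (a ℕ.* (k ℕ.* (b ℕ.* (j ℕ.* l)))) ℕ.* (s ℕ.* suc h)
  grp₂ = semiring
  inner : bin N j ℕ.* (j ! ℕ.* l !) ≡ N !
  inner = subst (λ m → bin m j ℕ.* (j ! ℕ.* l !) ≡ m !) (sym N≡) (bin-! j l)
  outer : bin (suc n) k ℕ.* (k ! ℕ.* N !) ≡ (suc n) !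
  outer = subst (λ m → bin m k ℕ.* (k ! ℕ.* N !) ≡ m !) (sym n≡) (bin-! k N)
  rhs : (+ bin (suc n) k ℤ.* + (suc h ℕ.* bin N j)) ℤ.* + C ≡ + target
  rhs = begin
    (+ bin (suc n) k ℤ.* + (suc h ℕ.* bin N j)) ℤ.* + C
      ≡⟨ cong (ℤ._* + C) (ℤ.pos-* (bin (suc n) k) _) ⟨
    + (bin (suc n) k ℕ.* (suc h ℕ.* bin N j)) ℤ.* + C
      ≡⟨ ℤ.pos-* (bin (suc n) k ℕ.* (suc h ℕ.* bin N j)) C ⟨
    + ((bin (suc n) k ℕ.* (suc h ℕ.* bin N j)) ℕ.* C)
      ≡⟨ cong +_ (grp₂ (bin (suc n) k) h (bin N j) (s !) (j !) (k !) (l !)) ⟩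
    + ((bin (suc n) k ℕ.* (k ! ℕ.* (bin N j ℕ.* (j ! ℕ.* l !)))) ℕ.* (s ! ℕ.* suc h))
      ≡⟨ cong (λ x → + ((bin (suc n) k ℕ.* (k ! ℕ.* x)) ℕ.* (s ! ℕ.* suc h))) inner ⟩
    + ((bin (suc n) k ℕ.* (k ! ℕ.* N !)) ℕ.* (s ! ℕ.* suc h))
      ≡⟨ cong (λ x → + (x ℕ.* (s ! ℕ.* suc h))) outer ⟩
    + target ∎

-- With s = n - j, truncation leaves only j ≤ d. By `term`, every surviving summand carries the
-- common factor C(n+1,k) and the weight d - j + 1, so the sum is a double prefix sum of binomials.
-- The factor n+1 keeps the formula free of division.
qS-formula : ∀ k d → let n = k ℕ.+ (k ℕ.+ d) in
  + suc n ℤ.* qS n k ≡ + (bin (suc n) k ℕ.* dbl (suc (k ℕ.+ d)) d)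
qS-formula k d = begin
  + suc n ℤ.* qS n k
    ≡⟨ cong (+ suc n ℤ.*_) (trans (Bin-sum n truncS k) (preℤ-reverse f n)) ⟩
  + suc n ℤ.* preℤ (λ j → f (n ∸ j)) n
    -- For j > d the index n - j is below 2k, where `truncS` vanishes in degree k.
    ≡⟨ cong (+ suc n ℤ.*_) (trans (cong (preℤ (λ j → f (n ∸ j))) (sym (ℕ.+-assoc k k d))) (preℤ-trim _ d (k ℕ.+ k) high)) ⟩
  + suc n ℤ.* preℤ (λ j → f (n ∸ j)) d
    ≡⟨ preℤ-scale (+ suc n) _ d ⟩
  preℤ (λ j → + suc n ℤ.* f (n ∸ j)) d
    ≡⟨ preℤ-cong d low ⟩
  preℤ (λ j → + bin (suc n) k ℤ.* + (suc (d ∸ j) ℕ.* bin N j)) d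
    ≡⟨ preℤ-scale (+ bin (suc n) k) _ d ⟨
  + bin (suc n) k ℤ.* preℤ (λ j → + (suc (d ∸ j) ℕ.* bin N j)) d
    ≡⟨ cong (+ bin (suc n) k ℤ.*_) (trans (sym (preℤ-pos _ d)) (cong +_ (sym (pre-pre (bin N) d)))) ⟩
  + bin (suc n) k ℤ.* + dbl N d
    ≡⟨ ℤ.pos-* (bin (suc n) k) (dbl N d) ⟨
  + (bin (suc n) k ℕ.* dbl N d) ∎
  where
  open ≡-Reasoning
  n = k ℕ.+ (k ℕ.+ d)
  N = suc (k ℕ.+ d)
  f : ℕ → ℤ
  f s = + bin n s ℤ.* truncS s k
  n∸d : n ∸ d ≡ 2 ℕ.* k
  n∸d = trans (cong (_∸ d) (eq k d)) (ℕ.m+n∸n≡m (2 ℕ.* k) d)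
    where
    eq : ∀ k d → k ℕ.+ (k ℕ.+ d) ≡ 2 ℕ.* k ℕ.+ d
    eq = semiring
  high : ∀ j → d < j → j ≤ (k ℕ.+ k) ℕ.+ d → f (n ∸ j) ≡ + 0
  high j p q rewrite truncS-high (n ∸ j) k (subst (n ∸ j <_) n∸d (ℕ.∸-monoʳ-< p (subst (j ≤_) (ℕ.+-assoc k k d) q))) =
    ℤ.*-zeroʳ (+ bin n (n ∸ j))
  low : ∀ j → j ≤ d → + suc n ℤ.* f (n ∸ j) ≡ + bin (suc n) k ℤ.* + (suc (d ∸ j) ℕ.* bin N j)
  low j p = begin
    + suc n ℤ.* f (n ∸ j)
      ≡⟨ cong₂ (λ m r → + suc m ℤ.* (+ bin m r ℤ.* truncS r k)) n≡ (trans (cong (_∸ j) n≡) (ℕ.m+n∸n≡m s j)) ⟩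
    + suc (s ℕ.+ j) ℤ.* (+ bin (s ℕ.+ j) s ℤ.* truncS s k)
      ≡⟨ cong (λ x → + suc (s ℕ.+ j) ℤ.* (+ bin (s ℕ.+ j) s ℤ.* x)) (truncS-low s k (ℕ.+-monoʳ-≤ k (ℕ.+-monoʳ-≤ k z≤n))) ⟩
    + suc (s ℕ.+ j) ℤ.* (+ bin (s ℕ.+ j) s ℤ.* ballotS s k)
      ≡⟨ term k h j ⟩
    + bin (suc (s ℕ.+ j)) k ℤ.* + (suc h ℕ.* bin (suc (k ℕ.+ (h ℕ.+ j))) j)
      ≡⟨ cong₂ (λ m x → + bin (suc m) k ℤ.* + (suc h ℕ.* bin (suc (k ℕ.+ x)) j)) (sym n≡) (ℕ.m∸n+n≡m p) ⟩
    + bin (suc n) k ℤ.* + (suc h ℕ.* bin N j) ∎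
    where
    h = d ∸ j
    s = k ℕ.+ (k ℕ.+ h)
    n≡ : n ≡ s ℕ.+ j
    n≡ = trans (cong (λ x → k ℕ.+ (k ℕ.+ x)) (sym (ℕ.m∸n+n≡m p))) (eq k h j)
      where
      eq : ∀ k h j → k ℕ.+ (k ℕ.+ (h ℕ.+ j)) ≡ (k ℕ.+ (k ℕ.+ h)) ℕ.+ j
      eq = semiring

qS-logConcave : ∀ n i → qS n i ℤ.* qS n (2 ℕ.+ i) ℤ.≤ qS n (suc i) ℤ.* qS n (suc i)
qS-logConcave n i with 2 ℕ.* (2 ℕ.+ i) ℕ.≤? n
-- Above half the degree the left side is zero and the right side is a square.
... | no p rewrite qS-high n (2 ℕ.+ i) (ℕ.≰⇒> p) | ℤ.*-zeroʳ (qS n i) = square (qS n (suc i))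
  where
  square : ∀ x → + 0 ℤ.≤ x ℤ.* x
  square (+ x)        = subst (+ 0 ℤ.≤_) (ℤ.pos-* x x) (ℤ.+≤+ z≤n)
  square ℤ.-[1+ x ]   = ℤ.+≤+ z≤n
... | yes p = ℤ.*-cancelˡ-≤-pos _ _ (+ suc n ℤ.* + suc n) (begin
  (+ suc n ℤ.* + suc n) ℤ.* (qS n i ℤ.* qS n (2 ℕ.+ i))
    ≡⟨ grp (+ suc n) (qS n i) (qS n (2 ℕ.+ i)) ⟩
  (+ suc n ℤ.* qS n i) ℤ.* (+ suc n ℤ.* qS n (2 ℕ.+ i))
    ≡⟨ cong₂ ℤ._*_ f₀ f₂ ⟩
  + (B 0 ℕ.* dbl (2 ℕ.+ N) (4 ℕ.+ d)) ℤ.* + (B 2 ℕ.* dbl N d)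
    ≡⟨ ℤ.pos-* (B 0 ℕ.* dbl (2 ℕ.+ N) (4 ℕ.+ d)) _ ⟨
  + ((B 0 ℕ.* dbl (2 ℕ.+ N) (4 ℕ.+ d)) ℕ.* (B 2 ℕ.* dbl N d))
    ≤⟨ ℤ.+≤+ (ℕ.≤-trans (ℕ.≤-reflexive (sym (ngrp (B 0) (B 2) (dbl (2 ℕ.+ N) (4 ℕ.+ d)) (dbl N d))))
         -- After multiplication by (n+1)² the claim is the product of two inequalities:
         -- log-concavity of k ↦ C(n+1,k), and the diagonal inequality for `dbl`.
         (ℕ.≤-trans (ℕ.*-mono-≤ (bin-PF₂ (suc n) i (suc i) (ℕ.n≤1+n i)) (dbl-diagonal N d))
                    (ℕ.≤-reflexive (ngrp′ (B 1) (dbl (suc N) (2 ℕ.+ d)))))) ⟩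
  + ((B 1 ℕ.* dbl (suc N) (2 ℕ.+ d)) ℕ.* (B 1 ℕ.* dbl (suc N) (2 ℕ.+ d)))
    ≡⟨ ℤ.pos-* (B 1 ℕ.* dbl (suc N) (2 ℕ.+ d)) _ ⟩
  + (B 1 ℕ.* dbl (suc N) (2 ℕ.+ d)) ℤ.* + (B 1 ℕ.* dbl (suc N) (2 ℕ.+ d))
    ≡⟨ cong₂ ℤ._*_ f₁ f₁ ⟨
  (+ suc n ℤ.* qS n (suc i)) ℤ.* (+ suc n ℤ.* qS n (suc i))
    ≡⟨ grp (+ suc n) (qS n (suc i)) (qS n (suc i)) ⟨
  (+ suc n ℤ.* + suc n) ℤ.* (qS n (suc i) ℤ.* qS n (suc i)) ∎)
  where
  open ℤ.≤-Reasoning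
  d = n ∸ 2 ℕ.* (2 ℕ.+ i)
  N = suc (2 ℕ.+ i ℕ.+ d)
  B : ℕ → ℕ
  B j = bin (suc n) (j ℕ.+ i)
  n≡ : 2 ℕ.* (2 ℕ.+ i) ℕ.+ d ≡ n
  n≡ = ℕ.m+[n∸m]≡n p
  f₀ : + suc n ℤ.* qS n i ≡ + (B 0 ℕ.* dbl (2 ℕ.+ N) (4 ℕ.+ d))
  f₀ = subst₂ (λ m M → + suc m ℤ.* qS m i ≡ + (bin (suc m) i ℕ.* dbl M (4 ℕ.+ d))) (trans (eq i d) n≡) (eq′ i d) (qS-formula i (4 ℕ.+ d))
    where
    eq : ∀ i d → i ℕ.+ (i ℕ.+ (4 ℕ.+ d)) ≡ 2 ℕ.* (2 ℕ.+ i) ℕ.+ d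
    eq = semiring
    eq′ : ∀ i d → 1 ℕ.+ (i ℕ.+ (4 ℕ.+ d)) ≡ 5 ℕ.+ (i ℕ.+ d)
    eq′ = semiring
  f₁ : + suc n ℤ.* qS n (suc i) ≡ + (B 1 ℕ.* dbl (suc N) (2 ℕ.+ d))
  f₁ = subst₂ (λ m M → + suc m ℤ.* qS m (suc i) ≡ + (bin (suc m) (suc i) ℕ.* dbl M (2 ℕ.+ d))) (trans (eq i d) n≡) (eq′ i d) (qS-formula (suc i) (2 ℕ.+ d))
    where
    eq : ∀ i d → (1 ℕ.+ i) ℕ.+ ((1 ℕ.+ i) ℕ.+ (2 ℕ.+ d)) ≡ 2 ℕ.* (2 ℕ.+ i) ℕ.+ d
    eq = semiring
    eq′ : ∀ i d → 1 ℕ.+ ((1 ℕ.+ i) ℕ.+ (2 ℕ.+ d)) ≡ 4 ℕ.+ (i ℕ.+ d)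
    eq′ = semiring
  f₂ : + suc n ℤ.* qS n (2 ℕ.+ i) ≡ + (B 2 ℕ.* dbl N d)
  f₂ = subst (λ m → + suc m ℤ.* qS m (2 ℕ.+ i) ≡ + (bin (suc m) (2 ℕ.+ i) ℕ.* dbl N d)) (trans (eq i d) n≡) (qS-formula (2 ℕ.+ i) d)
    where
    eq : ∀ i d → (2 ℕ.+ i) ℕ.+ ((2 ℕ.+ i) ℕ.+ d) ≡ 2 ℕ.* (2 ℕ.+ i) ℕ.+ d
    eq = semiring
  grp : ∀ m x y → (m ℤ.* m) ℤ.* (x ℤ.* y) ≡ (m ℤ.* x) ℤ.* (m ℤ.* y)
  grp = ring
  ngrp : ∀ a c x y → (a ℕ.* c) ℕ.* (y ℕ.* x) ≡ (a ℕ.* x) ℕ.* (c ℕ.* y)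
  ngrp = semiring
  ngrp′ : ∀ a x → (a ℕ.* a) ℕ.* (x ℕ.* x) ≡ (a ℕ.* x) ℕ.* (a ℕ.* x)
  ngrp′ = semiring

-- Coefficients of the polynomial operations

coeff-⊕ : ∀ p q → coeff (p ⊕ q) ≗ coeff p ⊞ coeff q
coeff-⊕ []      q       i       = sym (ℤ.+-identityˡ (coeff q i))
coeff-⊕ (a ∷ p) []      i       = sym (ℤ.+-identityʳ (coeff (a ∷ p) i))
coeff-⊕ (a ∷ p) (b ∷ q) zero    = refl
coeff-⊕ (a ∷ p) (b ∷ q) (suc i) = coeff-⊕ p q i

coeff-scale : ∀ c p → coeff (scale c p) ≗ c ⊙ coeff p
coeff-scale c []      i       = sym (ℤ.*-zeroʳ c)
coeff-scale c (a ∷ p) zero    = refl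
coeff-scale c (a ∷ p) (suc i) = coeff-scale c p i

coeff-monomial : ∀ a → coeff (monomial a) ≗ tpow a
coeff-monomial zero    zero    = refl
coeff-monomial zero    (suc i) = refl
coeff-monomial (suc a) zero    = refl
coeff-monomial (suc a) (suc i) = coeff-monomial a i

conv : Seq → Seq → Seq
conv a g zero    = a 0 ℤ.* g 0
conv a g (suc i) = a 0 ℤ.* g (suc i) ℤ.+ conv (a ∘ suc) g i

conv-cong : ∀ {a b g h} → a ≗ b → g ≗ h → conv a g ≗ conv b h
conv-cong p q zero    = cong₂ ℤ._*_ (p 0) (q 0)
conv-cong p q (suc i) = cong₂ ℤ._+_ (cong₂ ℤ._*_ (p 0) (q (suc i))) (conv-cong (p ∘ suc) q i)

conv-zeroˡ : ∀ g → conv 0S g ≗ 0S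
conv-zeroˡ g zero    = ℤ.*-zeroˡ (g 0)
conv-zeroˡ g (suc i) = cong₂ ℤ._+_ (ℤ.*-zeroˡ (g (suc i))) (conv-zeroˡ g i)

conv-tpow0ˡ : ∀ g → conv (tpow 0) g ≗ g
conv-tpow0ˡ g zero    = ℤ.*-identityˡ (g 0)
conv-tpow0ˡ g (suc i) = trans (cong₂ ℤ._+_ (ℤ.*-identityˡ (g (suc i))) (conv-zeroˡ g i)) (ℤ.+-identityʳ _)

conv-tpow0ʳ : ∀ a → conv a (tpow 0) ≗ a
conv-tpow0ʳ a zero    = ℤ.*-identityʳ (a 0)
conv-tpow0ʳ a (suc i) = trans (cong₂ ℤ._+_ (ℤ.*-zeroʳ (a 0)) (conv-tpow0ʳ (a ∘ suc) i)) (ℤ.+-identityˡ _)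

conv-linear : ∀ a → Linear (conv a)
conv-linear a .resp p = conv-cong {a} (λ _ → refl) p
conv-linear a .add f g zero    = ℤ.*-distribˡ-+ (a 0) (f 0) (g 0)
conv-linear a .add f g (suc i) =
  trans (cong (λ x → a 0 ℤ.* (f (suc i) ℤ.+ g (suc i)) ℤ.+ x) (add (conv-linear (a ∘ suc)) f g i))
        (eq (a 0) (f (suc i)) (g (suc i)) (conv (a ∘ suc) f i) (conv (a ∘ suc) g i))
  where
  eq : ∀ a x y u v → a ℤ.* (x ℤ.+ y) ℤ.+ (u ℤ.+ v) ≡ (a ℤ.* x ℤ.+ u) ℤ.+ (a ℤ.* y ℤ.+ v)
  eq = ring
conv-linear a .scl z f zero    = eq (a 0) z (f 0)
  where
  eq : ∀ a z x → a ℤ.* (z ℤ.* x) ≡ z ℤ.* (a ℤ.* x)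
  eq = ring
conv-linear a .scl z f (suc i) =
  trans (cong (λ x → a 0 ℤ.* (z ℤ.* f (suc i)) ℤ.+ x) (scl (conv-linear (a ∘ suc)) z f i))
        (eq (a 0) z (f (suc i)) (conv (a ∘ suc) f i))
  where
  eq : ∀ a z x u → a ℤ.* (z ℤ.* x) ℤ.+ z ℤ.* u ≡ z ℤ.* (a ℤ.* x ℤ.+ u)
  eq = ring

conv-shift : ∀ a → Commute (conv a) shift
conv-shift a f zero          = ℤ.*-zeroʳ (a 0)
conv-shift a f (suc zero)    =
  trans (cong (λ x → a 0 ℤ.* f 0 ℤ.+ x) (conv-shift (a ∘ suc) f zero)) (ℤ.+-identityʳ _)
conv-shift a f (suc (suc i)) = cong (λ x → a 0 ℤ.* f (suc i) ℤ.+ x) (conv-shift (a ∘ suc) f (suc i))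

-- Multiplication by a polynomial is linear and commutes with `shift`, hence with every power of a
-- linear factor.
conv-iter : ∀ a x y n f → conv a (iter (op x y) n f) ≗ iter (op x y) n (conv a f)
conv-iter a x y n f = iter-commute (conv-linear a) (op-linear x y) (op-commute (conv-linear a) (conv-shift a) x y) n f

coeff-⊗ : ∀ p q → coeff (p ⊗ q) ≗ conv (coeff p) (coeff q)
coeff-⊗ []      q i = sym (conv-zeroˡ (coeff q) i)
coeff-⊗ (a ∷ p) q i = trans (coeff-⊕ (scale a q) _ i) (trans (cong₂ ℤ._+_ (coeff-scale a q i) refl) (rest i))
  where
  rest : (a ⊙ coeff q) ⊞ coeff (+ 0 ∷ (p ⊗ q)) ≗ conv (coeff (a ∷ p)) (coeff q)
  rest zero    = ℤ.+-identityʳ _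
  rest (suc i) = cong (λ x → a ℤ.* coeff q (suc i) ℤ.+ x) (coeff-⊗ p q i)

coeff-applyUpTo : ∀ h n i → i < n → coeff (applyUpTo h n) i ≡ h i
coeff-applyUpTo h (suc n) zero    p       = refl
coeff-applyUpTo h (suc n) (suc i) (s≤s p) = coeff-applyUpTo (h ∘ suc) n i p

coeff-applyUpTo-high : ∀ h n i → n ≤ i → coeff (applyUpTo h n) i ≡ + 0
coeff-applyUpTo-high h zero    i       p       = refl
coeff-applyUpTo-high h (suc n) (suc i) (s≤s p) = coeff-applyUpTo-high (h ∘ suc) n i p

coeff-recip : ∀ d p i → i ≤ d → coeff (recip d p) i ≡ coeff p (d ∸ i)
coeff-recip d p i q rewrite List.map-upTo (λ i → coeff p (d ∸ i)) (suc d) = coeff-applyUpTo (λ i → coeff p (d ∸ i)) (suc d) i (s≤s q)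

coeff-recip-high : ∀ d p i → d < i → coeff (recip d p) i ≡ + 0
coeff-recip-high d p i q rewrite List.map-upTo (λ i → coeff p (d ∸ i)) (suc d) = coeff-applyUpTo-high (λ i → coeff p (d ∸ i)) (suc d) i q

module _ {P : ℕ → Set} (P? : ∀ i → Dec (P i)) (h : ℕ → ℤ) where

  -- Filtering a list of exponents and then reading coefficients could move them to other positions.
  -- A downward closed predicate keeps an initial segment, so every surviving coefficient stays in
  -- its own degree.
  Closed : (ℕ → ℕ) → Set
  Closed f = ∀ i → P (f (suc i)) → P (f i)

  closed-head : ∀ f → Closed f → ∀ i → P (f i) → P (f 0)
  closed-head f c zero    p = p
  closed-head f c (suc i) p = closed-head f c i (c i p)

  coeff-filter : ∀ f n → Closed f → ∀ i → i < n → P (f i) → coeff (map h (filter P? (applyUpTo f n))) i ≡ h (f i)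
  coeff-filter f (suc n) c i q p with P? (f 0)
  ... | no ¬p = contradiction (closed-head f c i p) ¬p
  coeff-filter f (suc n) c zero    q       p | yes _ = refl
  coeff-filter f (suc n) c (suc i) (s≤s q) p | yes _ = coeff-filter (f ∘ suc) n (c ∘ suc) i q p

  coeff-filter-high : ∀ f n → Closed f → ∀ i → ¬ P (f i) → coeff (map h (filter P? (applyUpTo f n))) i ≡ + 0
  coeff-filter-high f zero    c i ¬p = refl
  coeff-filter-high f (suc n) c i ¬p with P? (f 0)
  ... | no _ = coeff-filter-high (f ∘ suc) n (c ∘ suc) i (¬p ∘ c i)
  coeff-filter-high f (suc n) c zero    ¬p | yes p = contradiction p ¬p
  coeff-filter-high f (suc n) c (suc i) ¬p | yes p = coeff-filter-high (f ∘ suc) n (c ∘ suc) i ¬p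

half-closed : ∀ r i → 2 ℕ.* suc i < r → 2 ℕ.* i < r
half-closed r i = ℕ.<-trans (ℕ.*-monoʳ-< 2 (ℕ.n<1+n i))

coeff-trunc : ∀ r p i → 2 ℕ.* i < r → coeff (truncBelowHalf r p) i ≡ coeff p i
coeff-trunc r p i q = coeff-filter (λ i → 2 ℕ.* i ℕ.<? r) (coeff p) id r (half-closed r) i (ℕ.≤-<-trans (ℕ.m≤m+n i _) q) q

coeff-trunc-high : ∀ r p i → ¬ (2 ℕ.* i < r) → coeff (truncBelowHalf r p) i ≡ + 0
coeff-trunc-high r p i q = coeff-filter-high (λ i → 2 ℕ.* i ℕ.<? r) (coeff p) id r (half-closed r) i q

-- Sums over subsets

infixr 7 _◂_

_◂_ : Bool → Seq → Seq
true  ◂ f = f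
false ◂ f = 0S

◂-linear : ∀ b → Linear (b ◂_)
◂-linear true  = id-linear
◂-linear false .resp p _  = refl
◂-linear false .add f g _ = refl
◂-linear false .scl z f _ = sym (ℤ.*-zeroʳ z)

◂-cong : ∀ b {f g} → (b ≡ true → f ≗ g) → b ◂ f ≗ b ◂ g
◂-cong true  p = p refl
◂-cong false p = refl≗

◂-commute : ∀ b {F} → Linear F → ∀ f → F (b ◂ f) ≗ b ◂ F f
◂-commute true  l f = refl≗
◂-commute false l f = null l

-- Recursion on the characteristic vector lets a subset sum unfold one element at a time, and so one
-- spike, or two elements, at a time.
sumS : ∀ m → (Subset m → Seq) → Seq
sumS zero    f = f []
sumS (suc m) f = sumS m (λ s → f (false ∷ s) ⊞ f (true ∷ s))

sumS-at : ∀ m {f g : Subset m → Seq} i j → (∀ X → f X i ≡ g X j) → sumS m f i ≡ sumS m g j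
sumS-at zero    i j p = p []
sumS-at (suc m) i j p = sumS-at m i j (λ X → cong₂ ℤ._+_ (p (false ∷ X)) (p (true ∷ X)))

sumS-cong : ∀ m {f g : Subset m → Seq} → (∀ X → f X ≗ g X) → sumS m f ≗ sumS m g
sumS-cong m p i = sumS-at m i i (λ X → p X i)

sumS-linear : ∀ {F} → Linear F → ∀ m f → F (sumS m f) ≗ sumS m (F ∘ f)
sumS-linear l zero    f = refl≗
sumS-linear l (suc m) f = sumS-linear l m _ ∙ sumS-cong m (λ X → add l _ _)

sumS-add : ∀ m f g → sumS m (λ X → f X ⊞ g X) ≗ sumS m f ⊞ sumS m g
sumS-add zero    f g = refl≗
sumS-add (suc m) f g =
  sumS-cong m (λ X → ⊞-interchange (f (false ∷ X)) (g (false ∷ X)) (f (true ∷ X)) (g (true ∷ X)))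
  ∙ sumS-add m _ _

sumS-zero : ∀ m (f : Subset m → Seq) → (∀ X → f X ≗ 0S) → sumS m f ≗ 0S
sumS-zero zero    f p = p []
sumS-zero (suc m) f p = sumS-zero m _ (λ X → ⊞-cong (p (false ∷ X)) (p (true ∷ X)))

sumS-eqᵇ : ∀ m (G : Subset m) f → sumS m (λ F → eqᵇ F G ◂ f F) ≗ f G
sumS-eqᵇ zero    []          f = refl≗
sumS-eqᵇ (suc m) (true ∷ G)  f =
  sumS-cong m (λ X i → trans (cong (λ b → (b ◂ f (false ∷ X)) i ℤ.+ (eqᵇ X G ◂ f (true ∷ X)) i) (∧-zeroʳ (subsetᵇ X G))) (ℤ.+-identityˡ _))
  ∙ sumS-eqᵇ m G (λ X → f (true ∷ X))
sumS-eqᵇ (suc m) (false ∷ G) f =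
  sumS-cong m (λ X i → ℤ.+-identityʳ ((eqᵇ X G ◂ f (false ∷ X)) i))
  ∙ sumS-eqᵇ m G (λ X → f (false ∷ X))

lsum : {A : Set} → List A → (A → Seq) → Seq
lsum []       f = 0S
lsum (x ∷ xs) f = f x ⊞ lsum xs f

lsum-cong : ∀ {A : Set} (xs : List A) {f g} → (∀ x → f x ≗ g x) → lsum xs f ≗ lsum xs g
lsum-cong []       p = refl≗
lsum-cong (x ∷ xs) p = ⊞-cong (p x) (lsum-cong xs p)

coeff-polySum : ∀ {A : Set} (f : A → Poly) xs → coeff (polySum (map f xs)) ≗ lsum xs (coeff ∘ f)
coeff-polySum f []       = refl≗
coeff-polySum f (x ∷ xs) = coeff-⊕ (f x) (polySum (map f xs)) ∙ ⊞-cong {f = coeff (f x)} refl≗ (coeff-polySum f xs)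

lsum-filter : ∀ {A : Set} (p : A → Bool) xs f → lsum (filter (λ x → T? (p x)) xs) f ≗ lsum xs (λ x → p x ◂ f x)
lsum-filter p []       f = refl≗
lsum-filter p (x ∷ xs) f with p x
... | true  = ⊞-cong {f = f x} refl≗ (lsum-filter p xs f)
... | false = lsum-filter p xs f ∙ λ i → sym (ℤ.+-identityˡ _)

lsum-allSubsets : ∀ m f → lsum (allSubsets m) f ≗ sumS m f
lsum-allSubsets zero    f i = ℤ.+-identityʳ (f [] i)
lsum-allSubsets (suc m) f   = doubled (allSubsets m) ∙ lsum-allSubsets m _
  where
  doubled : ∀ ss → lsum (concatMap (λ s → (false ∷ s) ∷ (true ∷ s) ∷ []) ss) f ≗
                   lsum ss (λ s → f (false ∷ s) ⊞ f (true ∷ s))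
  doubled []       = refl≗
  doubled (s ∷ ss) i =
    trans (sym (ℤ.+-assoc (f (false ∷ s) i) (f (true ∷ s) i) _))
          (cong (λ x → f (false ∷ s) i ℤ.+ f (true ∷ s) i ℤ.+ x) (doubled ss i))

-- Reversed characteristic polynomials as sums over subsets.

tpow-refl : ∀ a → tpow a a ≡ + 1
tpow-refl zero    = refl
tpow-refl (suc a) = tpow-refl a

tpow-≢ : ∀ a i → a ≢ i → tpow a i ≡ + 0
tpow-≢ zero    zero    p = contradiction refl p
tpow-≢ zero    (suc i) p = refl
tpow-≢ (suc a) zero    p = refl
tpow-≢ (suc a) (suc i) p = tpow-≢ a i (p ∘ cong suc)

tpow-reflect : ∀ d a i → a ≤ d → i ≤ d → tpow (d ∸ a) (d ∸ i) ≡ tpow a i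
tpow-reflect d a i p q with a ℕ.≟ i
... | yes refl = trans (tpow-refl (d ∸ a)) (sym (tpow-refl a))
... | no  a≢i  = trans (tpow-≢ _ _ (a≢i ∘ ℕ.∸-cancelˡ-≡ p q)) (sym (tpow-≢ a i a≢i))

-- This is t^r χ(1/t), with r the rank: reversal replaces the exponent r - rk X by rk X.
charSum : Matroid → Seq
charSum N = sumS (m N) (λ X → subsetᵇ X (ground N) ◂ (sign ∣ X ∣ ⊙ tpow (rk N X)))

coeff-charPoly : ∀ N → coeff (charPoly N) ≗
  sumS (m N) (λ X → subsetᵇ X (ground N) ◂ (sign ∣ X ∣ ⊙ tpow (rank N ∸ rk N X)))
coeff-charPoly N =
  coeff-polySum (λ X → scale (sign ∣ X ∣) (monomial (rank N ∸ rk N X))) (filter (λ X → T? (subsetᵇ X (ground N))) (allSubsets (m N)))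
  ∙ lsum-cong (filter (λ X → T? (subsetᵇ X (ground N))) (allSubsets (m N)))
      (λ X → coeff-scale (sign ∣ X ∣) (monomial (rank N ∸ rk N X)) ∙ ⊙-cong (sign ∣ X ∣) (coeff-monomial (rank N ∸ rk N X)))
  ∙ lsum-filter (λ X → subsetᵇ X (ground N)) (allSubsets (m N)) _
  ∙ lsum-allSubsets (m N) _

-- Reversal moves degree r - rk X to rk X; the bound `rk N X ≤ rank N` ensures that the truncated
-- subtraction is a true one.
recip-charPoly : ∀ N → (∀ X → subsetᵇ X (ground N) ≡ true → rk N X ≤ rank N) →
                 coeff (recip (rank N) (charPoly N)) ≗ charSum N
recip-charPoly N mono i with i ℕ.≤? rank N
... | yes q = trans (coeff-recip (rank N) (charPoly N) i q)
                    (trans (coeff-charPoly N (rank N ∸ i)) (sumS-at (m N) _ i reflect))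
  where
  reflect : ∀ X → (subsetᵇ X (ground N) ◂ (sign ∣ X ∣ ⊙ tpow (rank N ∸ rk N X))) (rank N ∸ i) ≡
                  (subsetᵇ X (ground N) ◂ (sign ∣ X ∣ ⊙ tpow (rk N X))) i
  reflect X with subsetᵇ X (ground N) in e
  ... | true  = cong (sign ∣ X ∣ ℤ.*_) (tpow-reflect (rank N) (rk N X) i (mono X e) q)
  ... | false = refl
... | no ¬q = trans (coeff-recip-high (rank N) (charPoly N) i (ℕ.≰⇒> ¬q))
                    (sym (trans (sumS-at (m N) {g = λ _ → 0S} i i vanish) (sumS-zero (m N) (λ _ → 0S) (λ _ → refl≗) i)))
  where
  vanish : ∀ X → (subsetᵇ X (ground N) ◂ (sign ∣ X ∣ ⊙ tpow (rk N X))) i ≡ + 0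
  vanish X with subsetᵇ X (ground N) in e
  ... | true  = trans (cong (sign ∣ X ∣ ℤ.*_) (tpow-≢ (rk N X) i (λ { refl → ¬q (mono X e) }))) (ℤ.*-zeroʳ (sign ∣ X ∣))
  ... | false = refl

-- The recursion for the inverse Kazhdan–Lusztig polynomial

invKLaux-suc : ∀ k M r → rank M ≡ suc r → invKLaux (suc k) M ≡
  scale (sign r)
    (truncBelowHalf (suc r)
      (polySum (map (λ F → scale (sign (rk M F))
                              (invKLaux k (restrict M F) ⊗
                               recip (rank (contract M F)) (charPoly (contract M F))))
                    (filter (λ F → T? (not (eqᵇ F (ground M))))
                            (flats M)))))
invKLaux-suc k M r e with rank M | e
... | .(suc r) | refl = refl

invKLaux-rank0 : ∀ k M → rank M ≡ 0 → coeff (invKLaux k M) ≗ tpow 0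
invKLaux-rank0 zero    M e zero    = refl
invKLaux-rank0 zero    M e (suc i) = refl
invKLaux-rank0 (suc k) M e with rank M | e
... | .0 | refl = λ { zero → refl ; (suc i) → refl }

module _ (k : ℕ) (M : Matroid) (r : ℕ) (rank≡ : rank M ≡ suc r) (val : Subset (m M) → Seq)
  (val-flat : ∀ F → isFlat M F ≡ true → eqᵇ F (ground M) ≡ false →
     sign (rk M F) ⊙ conv (coeff (invKLaux k (restrict M F)))
                          (coeff (recip (rank (contract M F)) (charPoly (contract M F)))) ≗ val F)
  (flat-ground : isFlat M (ground M) ≡ true) where

  private
    G = ground M

    P R termPoly : Subset (m M) → Poly
    P F = invKLaux k (restrict M F)
    R F = recip (rank (contract M F)) (charPoly (contract M F))
    termPoly F = scale (sign (rk M F)) (P F ⊗ R F)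

    proper = filter (λ F → T? (not (eqᵇ F G))) (flats M)

    expansion : coeff (polySum (map termPoly proper)) ≗ sumS (m M) (λ F → isFlat M F ◂ not (eqᵇ F G) ◂ val F)
    expansion =
      coeff-polySum termPoly proper
      ∙ lsum-filter (λ F → not (eqᵇ F G)) (flats M) _
      ∙ lsum-filter (isFlat M) (allSubsets (m M)) _
      ∙ lsum-allSubsets (m M) _
      ∙ sumS-cong (m M) pointwise
      where
      pointwise : ∀ F → isFlat M F ◂ not (eqᵇ F G) ◂ coeff (termPoly F) ≗ isFlat M F ◂ not (eqᵇ F G) ◂ val F
      pointwise F with isFlat M F in e | eqᵇ F G in e′
      ... | false | _     = refl≗
      ... | true  | true  = refl≗
      ... | true  | false = coeff-scale (sign (rk M F)) (P F ⊗ R F) ∙ ⊙-cong (sign (rk M F)) (coeff-⊗ (P F) (R F)) ∙ val-flat F e e′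

    complete : sumS (m M) (λ F → isFlat M F ◂ not (eqᵇ F G) ◂ val F) ⊞ val G ≗ sumS (m M) (λ F → isFlat M F ◂ val F)
    complete =
      ⊞-cong {f = sumS (m M) (λ F → isFlat M F ◂ not (eqᵇ F G) ◂ val F)} refl≗
        ((λ i → cong (λ b → (b ◂ val G) i) (sym flat-ground)) ∙ sym≗ (sumS-eqᵇ (m M) G (λ F → isFlat M F ◂ val F)))
      ∙ sym≗ (sumS-add (m M) _ (λ F → eqᵇ F G ◂ isFlat M F ◂ val F))
      ∙ sumS-cong (m M) split
      where
      split : ∀ F → (isFlat M F ◂ not (eqᵇ F G) ◂ val F) ⊞ (eqᵇ F G ◂ isFlat M F ◂ val F) ≗ isFlat M F ◂ val F
      split F i with isFlat M F | eqᵇ F G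
      ... | true  | true  = ℤ.+-identityˡ _
      ... | true  | false = ℤ.+-identityʳ _
      ... | false | true  = refl
      ... | false | false = refl

  -- Closed forms exist for sums over all flats, while the recursion sums over proper ones. So `val`
  -- is also given at the ground set, where its value is added to complete the sum and then
  -- subtracted.
  invKLaux-low : ∀ i → 2 ℕ.* i < suc r → coeff (invKLaux (suc k) M) i ≡
                 sign r ℤ.* (sumS (m M) (λ F → isFlat M F ◂ val F) i ℤ.- val G i)
  invKLaux-low i q = begin
    coeff (invKLaux (suc k) M) i
      ≡⟨ cong (λ p → coeff p i) (invKLaux-suc k M r rank≡) ⟩
    coeff (scale (sign r) (truncBelowHalf (suc r) (polySum (map termPoly proper)))) i
      ≡⟨ coeff-scale (sign r) (truncBelowHalf (suc r) (polySum (map termPoly proper))) i ⟩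
    sign r ℤ.* coeff (truncBelowHalf (suc r) (polySum (map termPoly proper))) i
      ≡⟨ cong (sign r ℤ.*_) (trans (coeff-trunc (suc r) (polySum (map termPoly proper)) i q) (expansion i)) ⟩
    sign r ℤ.* S i
      ≡⟨ cong (sign r ℤ.*_) (cancel (S i) (val G i)) ⟩
    sign r ℤ.* ((S i ℤ.+ val G i) ℤ.- val G i)
      ≡⟨ cong (λ x → sign r ℤ.* (x ℤ.- val G i)) (complete i) ⟩
    sign r ℤ.* (sumS (m M) (λ F → isFlat M F ◂ val F) i ℤ.- val G i) ∎
    where
    open ≡-Reasoning
    S = sumS (m M) (λ F → isFlat M F ◂ not (eqᵇ F G) ◂ val F)
    cancel : ∀ x y → x ≡ (x ℤ.+ y) ℤ.- y
    cancel = ring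

  invKLaux-high : ∀ i → ¬ (2 ℕ.* i < suc r) → coeff (invKLaux (suc k) M) i ≡ + 0
  invKLaux-high i q = begin
    coeff (invKLaux (suc k) M) i
      ≡⟨ cong (λ p → coeff p i) (invKLaux-suc k M r rank≡) ⟩
    coeff (scale (sign r) (truncBelowHalf (suc r) (polySum (map termPoly proper)))) i
      ≡⟨ coeff-scale (sign r) (truncBelowHalf (suc r) (polySum (map termPoly proper))) i ⟩
    sign r ℤ.* coeff (truncBelowHalf (suc r) (polySum (map termPoly proper))) i
      ≡⟨ cong (sign r ℤ.*_) (coeff-trunc-high (suc r) (polySum (map termPoly proper)) i q) ⟩
    sign r ℤ.* + 0
      ≡⟨ ℤ.*-zeroʳ (sign r) ⟩
    + 0 ∎
    where open ≡-Reasoning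

-- Transfer along pointwise equal rank functions.

withRank : (M : Matroid) → (Subset (m M) → ℕ) → Matroid
withRank M ρ = record { m = m M ; ground = ground M ; rk = ρ }

allᵇ-cong : ∀ {A : Set} {f g : A → Bool} → f ≗ g → ∀ xs → allᵇ f xs ≡ allᵇ g xs
allᵇ-cong p []       = refl
allᵇ-cong p (x ∷ xs) = cong₂ _∧_ (p x) (allᵇ-cong p xs)

charPoly-cong : ∀ M ρ → rk M ≗ ρ → charPoly M ≡ charPoly (withRank M ρ)
charPoly-cong M ρ p = cong polySum (List.map-cong
  (λ X → cong₂ (λ a b → scale (sign ∣ X ∣) (monomial (a ∸ b))) (p (ground M)) (p X))
  (filter (λ X → T? (subsetᵇ X (ground M))) (allSubsets (m M))))

-- The two rank functions agree only pointwise, so the equality is carried through the recursion: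
-- flats coincide, and the rank functions of restrictions and contractions again agree pointwise.
invKLaux-cong : ∀ k M ρ → rk M ≗ ρ → invKLaux k M ≡ invKLaux k (withRank M ρ)
invKLaux-cong zero    M ρ p = refl
invKLaux-cong (suc k) M ρ p with rank M | rank (withRank M ρ) | p (ground M)
... | zero  | .zero    | refl = refl
... | suc r | .(suc r) | refl = cong (scale (sign r) ∘ truncBelowHalf (suc r) ∘ polySum) (begin
  map (termOf M) (filter proper? (flats M))
    ≡⟨ cong (map (termOf M) ∘ filter proper?) (List.filter-≐ (λ F → T? (isFlat M F)) (λ F → T? (isFlat M′ F)) ((λ {F} → subst T (flat≡ F)) , (λ {F} → subst T (sym (flat≡ F)))) (allSubsets (m M))) ⟩
  map (termOf M) (filter proper? (flats M′))
    ≡⟨ List.map-cong term≡ (filter proper? (flats M′)) ⟩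
  map (termOf M′) (filter proper? (flats M′)) ∎)
  where
  open ≡-Reasoning
  M′ = withRank M ρ
  proper? = λ F → T? (not (eqᵇ F (ground M)))
  termOf : (N : Matroid) → Subset (m N) → Poly
  termOf N F = scale (sign (rk N F)) (invKLaux k (restrict N F) ⊗ recip (rank (contract N F)) (charPoly (contract N F)))
  flat≡ : ∀ F → isFlat M F ≡ isFlat M′ F
  flat≡ F = cong (subsetᵇ F (ground M) ∧_) (allᵇ-cong
    (λ e → cong₂ (λ a b → not (mem e (ground M)) ∨ mem e F ∨ (a <ᵇ b)) (p F) (p (F ∪ ⁅ e ⁆))) (allFin (m M)))
  contract≡ : ∀ F X → rk (contract M F) X ≡ rk (contract M′ F) X
  contract≡ F X = cong₂ _∸_ (p (X ∪ F)) (p F)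
  term≡ : ∀ F → termOf M F ≡ termOf M′ F
  term≡ F = cong₂ scale (cong sign (p F)) (cong₂ _⊗_ (invKLaux-cong k (restrict M F) ρ p)
    (cong₂ recip (contract≡ F _) (charPoly-cong (contract M F) (rk (contract M′ F)) (contract≡ F))))

-- Edge sets of K_{1,1,n}, described spike by spike

spike : ℕ → List (ℕ × ℕ)
spike j = (0 , suc j) ∷ (1 , suc j) ∷ []

-- Edge sets are indexed by a list of spike labels rather than by n, so that recursion on the list
-- removes the two edges of a spike together.
#edges : List ℕ → ℕ
#edges js = length (concatMap spike js)

Spikes : List ℕ → Set
Spikes js = Subset (#edges js)

β : Bool → ℕ
β true  = 1
β false = 0

met : ∀ js → Spikes js → ℕ
met []       _           = 0
met (j ∷ js) (a ∷ b ∷ x) = β (a ∨ b) ℕ.+ met js x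

both : ∀ js → Spikes js → Bool
both []       _           = false
both (j ∷ js) (a ∷ b ∷ x) = (a ∧ b) ∨ both js x

-- The contribution of the spikes to rk (x ∪ f) ∸ rk f.
ν : ∀ js → Spikes js → Spikes js → ℕ
ν []       _           _           = 0
ν (j ∷ js) (a ∷ b ∷ x) (c ∷ d ∷ f) = β ((a ∨ b) ∧ not (c ∨ d)) ℕ.+ ν js x f

-- Every spike that is met attaches its outer vertex. One more is added when A and B are connected,
-- either by the edge AB itself or through a full spike.
ρ : ∀ js → Subset (suc (#edges js)) → ℕ
ρ js (b ∷ x) = β (b ∨ both js x) ℕ.+ met js x

Mat : ∀ js → Subset (suc (#edges js)) → Matroid
Mat js G = record { m = suc (#edges js) ; ground = G ; rk = ρ js }

-- Unions of full spikes. Together with AB, such a set with s spikes carries a copy of T_s.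
data Pure : ∀ js → Spikes js → Set where
  []  : Pure [] []
  off : ∀ {j js g} → Pure js g → Pure (j ∷ js) (false ∷ false ∷ g)
  on  : ∀ {j js g} → Pure js g → Pure (j ∷ js) (true ∷ true ∷ g)

-- At most one edge from each spike. Without AB such a set is a forest, so the restriction to it is
-- Boolean.
data Sparse : ∀ js → Spikes js → Set where
  []    : Sparse [] []
  none  : ∀ {j js g} → Sparse js g → Sparse (j ∷ js) (false ∷ false ∷ g)
  left  : ∀ {j js g} → Sparse js g → Sparse (j ∷ js) (true ∷ false ∷ g)
  right : ∀ {j js g} → Sparse js g → Sparse (j ∷ js) (false ∷ true ∷ g)

-- pureIn and sparseIn are only meaningful when g is a union of spikes: they read just one edge of
-- each spike of g.
pureIn : ∀ js → Spikes js → Spikes js → Bool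
pureIn []       _           _           = true
pureIn (j ∷ js) (c ∷ d ∷ g) (a ∷ b ∷ x) = local c a b ∧ pureIn js g x
  where
  local : Bool → Bool → Bool → Bool
  local true  true  b = b
  local true  false b = not b
  local false a     b = not (a ∨ b)

sparseIn : ∀ js → Spikes js → Spikes js → Bool
sparseIn []       _           _           = true
sparseIn (j ∷ js) (c ∷ d ∷ g) (a ∷ b ∷ x) = local c a b ∧ sparseIn js g x
  where
  local : Bool → Bool → Bool → Bool
  local true  a b = not (a ∧ b)
  local false a b = not (a ∨ b)

pureIn-subset : ∀ {js g} → Pure js g → ∀ x → pureIn js g x ≡ true → subsetᵇ x g ≡ true
pureIn-subset []      []                  e = refl
pureIn-subset (off p) (false ∷ false ∷ x) e = pureIn-subset p x e
pureIn-subset (on p)  (true ∷ true ∷ x)   e = pureIn-subset p x e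
pureIn-subset (on p)  (false ∷ false ∷ x) e = pureIn-subset p x e

pureIn-pure : ∀ {js g} → Pure js g → ∀ x → pureIn js g x ≡ true → Pure js x
pureIn-pure []      []                  e = []
pureIn-pure (off p) (false ∷ false ∷ x) e = off (pureIn-pure p x e)
pureIn-pure (on p)  (true ∷ true ∷ x)   e = on (pureIn-pure p x e)
pureIn-pure (on p)  (false ∷ false ∷ x) e = off (pureIn-pure p x e)

pureIn-refl : ∀ {js g} → Pure js g → pureIn js g g ≡ true
pureIn-refl []      = refl
pureIn-refl (off p) = pureIn-refl p
pureIn-refl (on p)  = pureIn-refl p

pureIn-≤ : ∀ {js g} → Pure js g → ∀ x → pureIn js g x ≡ true → met js x ≤ met js g
pureIn-≤ []      []                  e = z≤n
pureIn-≤ (off p) (false ∷ false ∷ x) e = pureIn-≤ p x e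
pureIn-≤ (on p)  (true ∷ true ∷ x)   e = s≤s (pureIn-≤ p x e)
pureIn-≤ (on p)  (false ∷ false ∷ x) e = ℕ.m≤n⇒m≤1+n (pureIn-≤ p x e)

pureIn-< : ∀ {js g} → Pure js g → ∀ x → pureIn js g x ≡ true → eqᵇ x g ≡ false → met js x < met js g
pureIn-< (off p) (false ∷ false ∷ x) e e′ = pureIn-< p x e e′
pureIn-< (on p)  (true ∷ true ∷ x)   e e′ = s≤s (pureIn-< p x e e′)
pureIn-< (on p)  (false ∷ false ∷ x) e e′ = s≤s (pureIn-≤ p x e)
pureIn-< []      []                  e ()

sparseIn-subset : ∀ {js g} → Pure js g → ∀ x → sparseIn js g x ≡ true → subsetᵇ x g ≡ true
sparseIn-subset []      []                  e = refl
sparseIn-subset (off p) (false ∷ false ∷ x) e = sparseIn-subset p x e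
sparseIn-subset (on p)  (true ∷ false ∷ x)  e = sparseIn-subset p x e
sparseIn-subset (on p)  (false ∷ b ∷ x)     e with b
... | true  = sparseIn-subset p x e
... | false = sparseIn-subset p x e

sparseIn-sparse : ∀ {js g} → Pure js g → ∀ x → sparseIn js g x ≡ true → Sparse js x
sparseIn-sparse []      []                  e = []
sparseIn-sparse (off p) (false ∷ false ∷ x) e = none (sparseIn-sparse p x e)
sparseIn-sparse (on p)  (true ∷ false ∷ x)  e = left (sparseIn-sparse p x e)
sparseIn-sparse (on p)  (false ∷ true ∷ x)  e = right (sparseIn-sparse p x e)
sparseIn-sparse (on p)  (false ∷ false ∷ x) e = none (sparseIn-sparse p x e)

sparseIn-≤ : ∀ {js g} → Pure js g → ∀ x → sparseIn js g x ≡ true → met js x ≤ met js g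
sparseIn-≤ []      []                  e = z≤n
sparseIn-≤ (off p) (false ∷ false ∷ x) e = sparseIn-≤ p x e
sparseIn-≤ (on p)  (true ∷ false ∷ x)  e = s≤s (sparseIn-≤ p x e)
sparseIn-≤ (on p)  (false ∷ true ∷ x)  e = s≤s (sparseIn-≤ p x e)
sparseIn-≤ (on p)  (false ∷ false ∷ x) e = ℕ.m≤n⇒m≤1+n (sparseIn-≤ p x e)

sparse-both : ∀ {js g} → Sparse js g → both js g ≡ false
sparse-both []        = refl
sparse-both (none s)  = sparse-both s
sparse-both (left s)  = sparse-both s
sparse-both (right s) = sparse-both s

sparse-subset : ∀ {js g} → Sparse js g → ∀ x → subsetᵇ x g ≡ true → Sparse js x
sparse-subset []        []                  e = []
sparse-subset (none s)  (false ∷ false ∷ x) e = none (sparse-subset s x e)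
sparse-subset (left s)  (true ∷ false ∷ x)  e = left (sparse-subset s x e)
sparse-subset (left s)  (false ∷ false ∷ x) e = none (sparse-subset s x e)
sparse-subset (right s) (false ∷ true ∷ x)  e = right (sparse-subset s x e)
sparse-subset (right s) (false ∷ false ∷ x) e = none (sparse-subset s x e)

subset-refl : ∀ {m} (x : Subset m) → subsetᵇ x x ≡ true
subset-refl []          = refl
subset-refl (true ∷ x)  = subset-refl x
subset-refl (false ∷ x) = subset-refl x

subset-∪ : ∀ {m} (x y f : Subset m) → subsetᵇ x y ≡ true → subsetᵇ (x ∪ f) (y ∪ f) ≡ true
subset-∪ []          []          []          e = refl
subset-∪ (true ∷ x)  (true ∷ y)  (c ∷ f)     e = subset-∪ x y f e
subset-∪ (false ∷ x) (true ∷ y)  (true ∷ f)  e = subset-∪ x y f e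
subset-∪ (false ∷ x) (true ∷ y)  (false ∷ f) e = subset-∪ x y f e
subset-∪ (false ∷ x) (false ∷ y) (true ∷ f)  e = subset-∪ x y f e
subset-∪ (false ∷ x) (false ∷ y) (false ∷ f) e = subset-∪ x y f e

met-mono : ∀ js x y → subsetᵇ x y ≡ true → met js x ≤ met js y
met-mono []       []                  []                  e = z≤n
met-mono (j ∷ js) (true ∷ true ∷ x)   (true ∷ true ∷ y)   e = s≤s (met-mono js x y e)
met-mono (j ∷ js) (true ∷ false ∷ x)  (true ∷ d ∷ y)      e = s≤s (met-mono js x y e)
met-mono (j ∷ js) (false ∷ true ∷ x)  (true ∷ true ∷ y)   e = s≤s (met-mono js x y e)
met-mono (j ∷ js) (false ∷ true ∷ x)  (false ∷ true ∷ y)  e = s≤s (met-mono js x y e)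
met-mono (j ∷ js) (false ∷ false ∷ x) (c ∷ d ∷ y)         e = ℕ.≤-trans (met-mono js x y e) (ℕ.m≤n+m _ (β (c ∨ d)))

both-mono : ∀ js x y → subsetᵇ x y ≡ true → both js x ≡ true → both js y ≡ true
both-mono (j ∷ js) (true ∷ true ∷ x)   (true ∷ true ∷ y)   e h = refl
both-mono (j ∷ js) (true ∷ false ∷ x)  (true ∷ true ∷ y)   e h = refl
both-mono (j ∷ js) (true ∷ false ∷ x)  (true ∷ false ∷ y)  e h = both-mono js x y e h
both-mono (j ∷ js) (false ∷ true ∷ x)  (true ∷ true ∷ y)   e h = refl
both-mono (j ∷ js) (false ∷ true ∷ x)  (false ∷ true ∷ y)  e h = both-mono js x y e h
both-mono (j ∷ js) (false ∷ false ∷ x) (true ∷ true ∷ y)   e h = refl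
both-mono (j ∷ js) (false ∷ false ∷ x) (true ∷ false ∷ y)  e h = both-mono js x y e h
both-mono (j ∷ js) (false ∷ false ∷ x) (false ∷ d ∷ y)     e h = both-mono js x y e h

β-mono : ∀ {a b} → (a ≡ true → b ≡ true) → β a ≤ β b
β-mono {false}         p = z≤n
β-mono {true}  {true}  p = s≤s z≤n
β-mono {true}  {false} p with () ← p refl

ρ-mono : ∀ js X Y → subsetᵇ X Y ≡ true → ρ js X ≤ ρ js Y
ρ-mono js (true ∷ x)  (true ∷ y)  e = s≤s (met-mono js x y e)
ρ-mono js (false ∷ x) (true ∷ y)  e = ℕ.+-mono-≤ (β-mono {both js x} (λ _ → refl)) (met-mono js x y e)
ρ-mono js (false ∷ x) (false ∷ y) e = ℕ.+-mono-≤ (β-mono (both-mono js x y e)) (met-mono js x y e)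

met-∪ : ∀ js x f → met js (x ∪ f) ≡ ν js x f ℕ.+ met js f
met-∪ []       []          []          = refl
met-∪ (j ∷ js) (a ∷ b ∷ x) (c ∷ d ∷ f) =
  trans (cong₂ ℕ._+_ (local a b c d) (met-∪ js x f)) (swap (β ((a ∨ b) ∧ not (c ∨ d))) (β (c ∨ d)) (ν js x f) (met js f))
  where
  swap : ∀ x y z w → (x ℕ.+ y) ℕ.+ (z ℕ.+ w) ≡ (x ℕ.+ z) ℕ.+ (y ℕ.+ w)
  swap = semiring
  one : ∀ e → 1 ≡ β (not e) ℕ.+ β e
  one true  = refl
  one false = refl
  local : ∀ a b c d → β ((a ∨ c) ∨ (b ∨ d)) ≡ β ((a ∨ b) ∧ not (c ∨ d)) ℕ.+ β (c ∨ d)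
  local true  b     c     d = one (c ∨ d)
  local false true  true  d = refl
  local false true  false d = one d
  local false false c     d = refl

ν-self : ∀ js g → ν js g g ≡ 0
ν-self []       []          = refl
ν-self (j ∷ js) (a ∷ b ∷ g) = cong₂ ℕ._+_ (local (a ∨ b)) (ν-self js g)
  where
  local : ∀ e → β (e ∧ not e) ≡ 0
  local true  = refl
  local false = refl

-- Flats

pure-grow : ∀ {js g} → Pure js g → ∀ x e → pureIn js g x ≡ true → mem e g ≡ true → mem e x ≡ false →
            met js x < met js (x ∪ ⁅ e ⁆)
pure-grow (on p)  (false ∷ false ∷ x) zero          h i o rewrite ∪-identityʳ x = ℕ.≤-refl
pure-grow (on p)  (false ∷ false ∷ x) (suc zero)    h i o rewrite ∪-identityʳ x = ℕ.≤-refl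
pure-grow (on p)  (true ∷ true ∷ x)   (suc (suc e)) h i o = s≤s (pure-grow p x e h i o)
pure-grow (on p)  (false ∷ false ∷ x) (suc (suc e)) h i o = pure-grow p x e h i o
pure-grow (off p) (false ∷ false ∷ x) (suc (suc e)) h i o = pure-grow p x e h i o

-- A subset of a union of spikes that is not itself one contains half of some spike. In the presence
-- of AB, the other half closes a triangle and does not raise the rank.
pure-stuck : ∀ {js g} → Pure js g → ∀ x → subsetᵇ x g ≡ true → pureIn js g x ≡ false →
             ∃ λ e → mem e g ≡ true × mem e x ≡ false × met js (x ∪ ⁅ e ⁆) ≡ met js x
pure-stuck {j ∷ js} (on p) (true ∷ false ∷ x) s h = suc zero , refl , refl , cong (λ y → suc (met js y)) (∪-identityʳ x)
pure-stuck {j ∷ js} (on p) (false ∷ true ∷ x) s h = zero , refl , refl , cong (λ y → suc (met js y)) (∪-identityʳ x)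
pure-stuck (on p) (true ∷ true ∷ x) s h =
  let e , i , o , q = pure-stuck p x s h in suc (suc e) , i , o , cong suc q
pure-stuck (on p) (false ∷ false ∷ x) s h =
  let e , i , o , q = pure-stuck p x s h in suc (suc e) , i , o , q
pure-stuck (off p) (false ∷ false ∷ x) s h =
  let e , i , o , q = pure-stuck p x s h in suc (suc e) , i , o , q

-- A new edge either meets a new spike or completes the first full spike, which connects A to B.
sparse-grow : ∀ {js x} → Sparse js x → ∀ e → mem e x ≡ false →
              met js x < β (both js (x ∪ ⁅ e ⁆)) ℕ.+ met js (x ∪ ⁅ e ⁆)
sparse-grow {x = _ ∷ _ ∷ x} (none s)  zero          o rewrite ∪-identityʳ x | sparse-both s = ℕ.≤-refl
sparse-grow {x = _ ∷ _ ∷ x} (none s)  (suc zero)    o rewrite ∪-identityʳ x | sparse-both s = ℕ.≤-refl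
sparse-grow                 (none s)  (suc (suc e)) o = sparse-grow s e o
sparse-grow {x = _ ∷ _ ∷ x} (left s)  (suc zero)    o rewrite ∪-identityʳ x = ℕ.≤-refl
sparse-grow {j ∷ js}        (left s)  (suc (suc e)) o =
  ℕ.≤-trans (s≤s (sparse-grow s e o)) (ℕ.≤-reflexive (sym (ℕ.+-suc _ _)))
sparse-grow {x = _ ∷ _ ∷ x} (right s) zero          o rewrite ∪-identityʳ x = ℕ.≤-refl
sparse-grow {j ∷ js}        (right s) (suc (suc e)) o =
  ℕ.≤-trans (s≤s (sparse-grow s e o)) (ℕ.≤-reflexive (sym (ℕ.+-suc _ _)))

sparseIn-fail : ∀ {js g} → Pure js g → ∀ x → subsetᵇ x g ≡ true → sparseIn js g x ≡ false → both js x ≡ true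
sparseIn-fail (on p)  (true ∷ true ∷ x)   s h = refl
sparseIn-fail (on p)  (true ∷ false ∷ x)  s h = sparseIn-fail p x s h
sparseIn-fail (on p)  (false ∷ true ∷ x)  s h = sparseIn-fail p x s h
sparseIn-fail (on p)  (false ∷ false ∷ x) s h = sparseIn-fail p x s h
sparseIn-fail (off p) (false ∷ false ∷ x) s h = sparseIn-fail p x s h

<ᵇ-true : ∀ {m n} → m < n → (m <ᵇ n) ≡ true
<ᵇ-true {m} {n} p with m <ᵇ n | ℕ.<⇒<ᵇ p
... | true | _ = refl

<ᵇ-irrefl : ∀ n → (n <ᵇ n) ≡ false
<ᵇ-irrefl zero    = refl
<ᵇ-irrefl (suc n) = <ᵇ-irrefl n

allᵇ-tabulate : ∀ {A : Set} (f : A → Bool) {m} (g : Fin m → A) → (∀ e → f (g e) ≡ true) → allᵇ f (tabulate g) ≡ true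
allᵇ-tabulate f {zero}  g p = refl
allᵇ-tabulate f {suc m} g p rewrite p zero = allᵇ-tabulate f (g ∘ suc) (p ∘ suc)

allᵇ-tabulate-false : ∀ {A : Set} (f : A → Bool) {m} (g : Fin m → A) e → f (g e) ≡ false → allᵇ f (tabulate g) ≡ false
allᵇ-tabulate-false f g zero    p rewrite p = refl
allᵇ-tabulate-false f g (suc e) p = trans (cong (f (g zero) ∧_) (allᵇ-tabulate-false f (g ∘ suc) e p)) (∧-zeroʳ (f (g zero)))

module _ (M : Matroid) where

  isFlat-true : ∀ F → subsetᵇ F (ground M) ≡ true →
    (∀ e → mem e (ground M) ≡ true → mem e F ≡ false → rk M F < rk M (F ∪ ⁅ e ⁆)) → isFlat M F ≡ true
  isFlat-true F s p rewrite s = allᵇ-tabulate test id pointwise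
    where
    test : Fin (m M) → Bool
    test e = not (mem e (ground M)) ∨ mem e F ∨ (rk M F <ᵇ rk M (F ∪ ⁅ e ⁆))
    pointwise : ∀ e → test e ≡ true
    pointwise e with mem e (ground M) in i | mem e F in o
    ... | false | _     = refl
    ... | true  | true  = refl
    ... | true  | false = <ᵇ-true (p e i o)

  isFlat-stuck : ∀ F e → mem e (ground M) ≡ true → mem e F ≡ false → rk M (F ∪ ⁅ e ⁆) ≡ rk M F → isFlat M F ≡ false
  isFlat-stuck F e i o q =
    trans (cong (subsetᵇ F (ground M) ∧_) (allᵇ-tabulate-false test id e stuck)) (∧-zeroʳ (subsetᵇ F (ground M)))
    where
    test : Fin (m M) → Bool
    test e = not (mem e (ground M)) ∨ mem e F ∨ (rk M F <ᵇ rk M (F ∪ ⁅ e ⁆))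
    stuck : test e ≡ false
    stuck rewrite i | o | q = <ᵇ-irrefl (rk M F)

  isFlat-false : ∀ F → (subsetᵇ F (ground M) ≡ true → isFlat M F ≡ false) → isFlat M F ≡ false
  isFlat-false F p = go (subsetᵇ F (ground M)) refl
    where
    go : ∀ b → subsetᵇ F (ground M) ≡ b → isFlat M F ≡ false
    go true  s = p s
    go false s rewrite s = refl

isFlat-AB : ∀ {js g} → Pure js g → ∀ x → isFlat (Mat js (true ∷ g)) (true ∷ x) ≡ pureIn js g x
isFlat-AB {js} {g} p x with pureIn js g x in h
... | true  = isFlat-true (Mat js (true ∷ g)) (true ∷ x) (pureIn-subset p x h) λ where
  (suc e) i o → s≤s (pure-grow p x e h i o)
... | false = isFlat-false (Mat js (true ∷ g)) (true ∷ x) λ s →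
  let e , i , o , q = pure-stuck p x s h in isFlat-stuck (Mat js (true ∷ g)) (true ∷ x) (suc e) i o (cong suc q)

sparse-ρ-grow : ∀ {js x} → Sparse js x → ∀ e → mem e x ≡ false → ρ js (false ∷ x) < ρ js ((false ∷ x) ∪ ⁅ suc e ⁆)
sparse-ρ-grow {js} {x} s e o =
  subst (λ b → β b ℕ.+ met js x < ρ js ((false ∷ x) ∪ ⁅ suc e ⁆)) (sym (sparse-both s)) (sparse-grow s e o)

-- A full spike spans AB, so a flat avoiding AB contains none; this makes AB the witness in the
-- failing case.
isFlat-noAB : ∀ {js g} → Pure js g → ∀ x → isFlat (Mat js (true ∷ g)) (false ∷ x) ≡ sparseIn js g x
isFlat-noAB {js} {g} p x with sparseIn js g x in h
... | true  = isFlat-true (Mat js (true ∷ g)) (false ∷ x) (sparseIn-subset p x h) grow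
  where
  s = sparseIn-sparse p x h
  grow : ∀ e → mem e (true ∷ g) ≡ true → mem e (false ∷ x) ≡ false → ρ js (false ∷ x) < ρ js ((false ∷ x) ∪ ⁅ e ⁆)
  grow zero    i o = subst₂ (λ b y → β b ℕ.+ met js x < suc (met js y)) (sym (sparse-both s)) (sym (∪-identityʳ x)) ℕ.≤-refl
  grow (suc e) i o = sparse-ρ-grow s e o
... | false = isFlat-false (Mat js (true ∷ g)) (false ∷ x) λ s → isFlat-stuck (Mat js (true ∷ g)) (false ∷ x) zero refl refl
  (trans (cong (λ y → suc (met js y)) (∪-identityʳ x)) (cong (λ b → β b ℕ.+ met js x) (sym (sparseIn-fail p x s h))))

isFlat-sparse : ∀ {js g} → Sparse js g → ∀ x → isFlat (Mat js (false ∷ g)) (false ∷ x) ≡ subsetᵇ x g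
isFlat-sparse {js} {g} s x = go (subsetᵇ x g) refl
  where
  go : ∀ b → subsetᵇ x g ≡ b → isFlat (Mat js (false ∷ g)) (false ∷ x) ≡ b
  go false h = isFlat-false (Mat js (false ∷ g)) (false ∷ x) λ h′ → contradiction (trans (sym h) h′) λ ()
  go true  h = isFlat-true (Mat js (false ∷ g)) (false ∷ x) h λ where
    (suc e) i o → sparse-ρ-grow (sparse-subset s x h) e o

-- Characteristic polynomials of the contractions

-- Multiplication by 1 - 2t, the factor of an untouched spike when full spikes are excluded: neither
-- edge, or one of two edges with weight -t each.
K : Seq → Seq
K = op (+ 1) (- + 2)

L-linear : Linear L
L-linear = op-linear (+ 1) (- + 1)

K-linear : Linear K
K-linear = op-linear (+ 1) (- + 2)

only₁ : ∀ f → (f ⊞ 0S) ⊞ (0S ⊞ 0S) ≗ f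
only₁ f i = eq (f i)
  where
  eq : ∀ x → (x ℤ.+ + 0) ℤ.+ (+ 0 ℤ.+ + 0) ≡ x
  eq = ring

outer₂ : ∀ f g → (f ⊞ 0S) ⊞ (0S ⊞ g) ≗ f ⊞ g
outer₂ f g i = cong₂ ℤ._+_ (ℤ.+-identityʳ (f i)) (ℤ.+-identityˡ (g i))

even₂ : ∀ f g → (f ⊞ 0S) ⊞ (g ⊞ 0S) ≗ f ⊞ g
even₂ f g i = cong₂ ℤ._+_ (ℤ.+-identityʳ (f i)) (ℤ.+-identityʳ (g i))

-- With AB contracted the two edges of an untouched spike are parallel, and the four choices give 1
-- - t - t + t = 1 - t.
spike-L : ∀ u z p → ((u ◂ (z ⊙ p)) ⊞ (u ◂ (- z ⊙ shift p))) ⊞ ((u ◂ (- z ⊙ shift p)) ⊞ (u ◂ (- (- z) ⊙ shift p))) ≗ L (u ◂ (z ⊙ p))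
spike-L true  z p i = trans (eq z (p i) (shift p i)) (cong (λ x → + 1 ℤ.* (z ℤ.* p i) ℤ.+ - + 1 ℤ.* x) (sym (scl shift-linear z p i)))
  where
  eq : ∀ z x y → (z ℤ.* x ℤ.+ - z ℤ.* y) ℤ.+ (- z ℤ.* y ℤ.+ - (- z) ℤ.* y) ≡ + 1 ℤ.* (z ℤ.* x) ℤ.+ - + 1 ℤ.* (z ℤ.* y)
  eq = ring
spike-L false z p i = sym (null L-linear i)

edge-L : ∀ u z p → (u ◂ (z ⊙ p)) ⊞ (u ◂ (- z ⊙ shift p)) ≗ L (u ◂ (z ⊙ p))
edge-L true  z p i = trans (eq z (p i) (shift p i)) (cong (λ x → + 1 ℤ.* (z ℤ.* p i) ℤ.+ - + 1 ℤ.* x) (sym (scl shift-linear z p i)))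
  where
  eq : ∀ z x y → z ℤ.* x ℤ.+ - z ℤ.* y ≡ + 1 ℤ.* (z ℤ.* x) ℤ.+ - + 1 ℤ.* (z ℤ.* y)
  eq = ring
edge-L false z p i = sym (null L-linear i)

spike-K : ∀ u z p → ((u ◂ (z ⊙ p)) ⊞ (u ◂ (- z ⊙ shift p))) ⊞ ((u ◂ (- z ⊙ shift p)) ⊞ 0S) ≗ K (u ◂ (z ⊙ p))
spike-K true  z p i = trans (eq z (p i) (shift p i)) (cong (λ x → + 1 ℤ.* (z ℤ.* p i) ℤ.+ - + 2 ℤ.* x) (sym (scl shift-linear z p i)))
  where
  eq : ∀ z x y → (z ℤ.* x ℤ.+ - z ℤ.* y) ℤ.+ (- z ℤ.* y ℤ.+ + 0) ≡ + 1 ℤ.* (z ℤ.* x) ℤ.+ - + 2 ℤ.* (z ℤ.* y)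
  eq = ring
spike-K false z p i = sym (null K-linear i)

module _ (js : List ℕ) (g f : Spikes js) where

  -- The two summand shapes left once AB is dealt with: the rank increment is `ν` in both, and
  -- `sparseTerm` also forbids a full spike in `x ∪ f`.
  freeTerm sparseTerm : Spikes js → Seq
  freeTerm x   = subsetᵇ x (g ─ f) ◂ (sign ∣ x ∣ ⊙ tpow (ν js x f))
  sparseTerm x = (subsetᵇ x (g ─ f) ∧ not (both js (x ∪ f))) ◂ (sign ∣ x ∣ ⊙ tpow (ν js x f))

  freeSum sparseSum : Seq
  freeSum   = sumS (#edges js) freeTerm
  sparseSum = sumS (#edges js) sparseTerm

step : ∀ js {F : Seq → Seq} (l : Linear F) {t : Spikes js → Seq} (t′ : Spikes js → Seq) n →
       (∀ x → t x ≗ F (t′ x)) → sumS (#edges js) t′ ≗ iter F n (tpow 0) →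
       sumS (#edges js) t ≗ iter F (suc n) (tpow 0)
step js l t′ n p ih = sumS-cong (#edges js) p ∙ sym≗ (sumS-linear l (#edges js) t′) ∙ resp l ih

freeSum-pure : ∀ {js g} → Pure js g → ∀ f → pureIn js g f ≡ true → freeSum js g f ≗ iter L (ν js g f) (tpow 0)
freeSum-pure []      []                  e i = ℤ.*-identityˡ (tpow 0 i)
freeSum-pure {j ∷ js} {_ ∷ _ ∷ g} (off p) (false ∷ false ∷ f) e =
  sumS-cong (#edges js) (λ x → only₁ (freeTerm js g f x)) ∙ freeSum-pure p f e
freeSum-pure {j ∷ js} {_ ∷ _ ∷ g} (on p)  (true ∷ true ∷ f)   e =
  sumS-cong (#edges js) (λ x → only₁ (freeTerm js g f x)) ∙ freeSum-pure p f e
freeSum-pure {j ∷ js} {_ ∷ _ ∷ g} (on p)  (false ∷ false ∷ f) e =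
  step js L-linear (freeTerm js g f) (ν js g f) (λ x → spike-L (subsetᵇ x (g ─ f)) (sign ∣ x ∣) (tpow (ν js x f))) (freeSum-pure p f e)

freeSum-sparse : ∀ {js g} → Sparse js g → ∀ f → subsetᵇ f g ≡ true → freeSum js g f ≗ iter L (ν js g f) (tpow 0)
freeSum-sparse []        []                  e i = ℤ.*-identityˡ (tpow 0 i)
freeSum-sparse {j ∷ js} {_ ∷ _ ∷ g} (none s)  (false ∷ false ∷ f) e =
  sumS-cong (#edges js) (λ x → only₁ (freeTerm js g f x)) ∙ freeSum-sparse s f e
freeSum-sparse {j ∷ js} {_ ∷ _ ∷ g} (left s)  (true ∷ false ∷ f)  e =
  sumS-cong (#edges js) (λ x → only₁ (freeTerm js g f x)) ∙ freeSum-sparse s f e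
freeSum-sparse {j ∷ js} {_ ∷ _ ∷ g} (left s)  (false ∷ false ∷ f) e =
  step js L-linear (freeTerm js g f) (ν js g f)
    (λ x → (λ i → ℤ.+-identityʳ _) ∙ edge-L (subsetᵇ x (g ─ f)) (sign ∣ x ∣) (tpow (ν js x f))) (freeSum-sparse s f e)
freeSum-sparse {j ∷ js} {_ ∷ _ ∷ g} (right s) (false ∷ true ∷ f)  e =
  sumS-cong (#edges js) (λ x → only₁ (freeTerm js g f x)) ∙ freeSum-sparse s f e
freeSum-sparse {j ∷ js} {_ ∷ _ ∷ g} (right s) (false ∷ false ∷ f) e =
  step js L-linear (freeTerm js g f) (ν js g f)
    (λ x → even₂ (freeTerm js g f x) (subsetᵇ x (g ─ f) ◂ (- sign ∣ x ∣ ⊙ shift (tpow (ν js x f))))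
           ∙ edge-L (subsetᵇ x (g ─ f)) (sign ∣ x ∣) (tpow (ν js x f)))
    (freeSum-sparse s f e)

∧-guard-false : ∀ u f → (u ∧ false) ◂ f ≗ 0S
∧-guard-false true  f = refl≗
∧-guard-false false f = refl≗

sparseSum-pure : ∀ {js g} → Pure js g → ∀ f → sparseIn js g f ≡ true → sparseSum js g f ≗ iter K (ν js g f) (tpow 0)
sparseSum-pure []      []                  e i = ℤ.*-identityˡ (tpow 0 i)
sparseSum-pure {j ∷ js} {_ ∷ _ ∷ g} (off p) (false ∷ false ∷ f) e =
  sumS-cong (#edges js) (λ x → only₁ (sparseTerm js g f x)) ∙ sparseSum-pure p f e
sparseSum-pure {j ∷ js} {_ ∷ _ ∷ g} (on p)  (true ∷ false ∷ f)  e =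
  sumS-cong (#edges js) (λ x → ⊞-cong {f = sparseTerm js g f x ⊞ 0S} refl≗ (⊞-cong (∧-guard-false (subsetᵇ x (g ─ f)) _) refl≗)
                              ∙ only₁ (sparseTerm js g f x))
  ∙ sparseSum-pure p f e
sparseSum-pure {j ∷ js} {_ ∷ _ ∷ g} (on p)  (false ∷ true ∷ f)  e =
  sumS-cong (#edges js) (λ x → ⊞-cong (⊞-cong {f = sparseTerm js g f x} refl≗ (∧-guard-false (subsetᵇ x (g ─ f)) _)) refl≗
                              ∙ only₁ (sparseTerm js g f x))
  ∙ sparseSum-pure p f e
sparseSum-pure {j ∷ js} {_ ∷ _ ∷ g} (on p)  (false ∷ false ∷ f) e =
  step js K-linear (sparseTerm js g f) (ν js g f)
    (λ x → let u = subsetᵇ x (g ─ f) ∧ not (both js (x ∪ f))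
               B = u ◂ (- sign ∣ x ∣ ⊙ shift (tpow (ν js x f))) in
       ⊞-cong {f = sparseTerm js g f x ⊞ B} refl≗
         (⊞-cong {f = B} refl≗ (∧-guard-false (subsetᵇ x (g ─ f)) (- (- sign ∣ x ∣) ⊙ shift (tpow (ν js x f)))))
       ∙ spike-K u (sign ∣ x ∣) (tpow (ν js x f)))
    (sparseSum-pure p f e)

contract-rank : ∀ js G F X → subsetᵇ X (G ─ F) ≡ true →
                rk (contract (Mat js G) F) X ≤ rank (contract (Mat js G) F)
contract-rank js G F X e = ℕ.∸-monoˡ-≤ (ρ js F) (ρ-mono js (X ∪ F) ((G ─ F) ∪ F) (subset-∪ X (G ─ F) F e))

recip-char : ∀ js G F → coeff (recip (rank (contract (Mat js G) F)) (charPoly (contract (Mat js G) F)))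
                        ≗ charSum (contract (Mat js G) F)
recip-char js G F = recip-charPoly (contract (Mat js G) F) (contract-rank js G F)

ν-∸ : ∀ js x f → met js (x ∪ f) ∸ met js f ≡ ν js x f
ν-∸ js x f = trans (cong (_∸ met js f) (met-∪ js x f)) (ℕ.m+n∸n≡m (ν js x f) (met js f))

charSum-AB : ∀ js g f → charSum (contract (Mat js (true ∷ g)) (true ∷ f)) ≗ freeSum js g f
charSum-AB js g f = sumS-cong (#edges js) λ x i →
  trans (ℤ.+-identityʳ _) (cong (λ a → (subsetᵇ x (g ─ f) ◂ (sign ∣ x ∣ ⊙ tpow a)) i) (ν-∸ js x f))

-- Sets are paired by adding AB. If `x ∪ f` contains a full spike, AB is already spanned and the
-- pair cancels; otherwise AB raises the rank by one and the pair gives the factor 1 - t.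
charSum-noAB : ∀ {js f} g → Sparse js f → charSum (contract (Mat js (true ∷ g)) (false ∷ f)) ≗ L (sparseSum js g f)
charSum-noAB {js} {f} g s = sumS-cong (#edges js) pointwise ∙ sym≗ (sumS-linear L-linear (#edges js) (sparseTerm js g f))
  where
  cancel : ∀ u z p → (u ◂ (z ⊙ shift p)) ⊞ (u ◂ (- z ⊙ shift p)) ≗ L 0S
  cancel true  z p i = trans (eq z (shift p i)) (sym (null L-linear i))
    where
    eq : ∀ z y → z ℤ.* y ℤ.+ - z ℤ.* y ≡ + 0
    eq = ring
  cancel false z p i = sym (null L-linear i)
  pointwise : ∀ x →
    (subsetᵇ x (g ─ f) ◂ (sign ∣ x ∣ ⊙ tpow ((β (both js (x ∪ f)) ℕ.+ met js (x ∪ f)) ∸ (β (both js f) ℕ.+ met js f))))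
    ⊞ (subsetᵇ x (g ─ f) ◂ (- sign ∣ x ∣ ⊙ tpow (suc (met js (x ∪ f)) ∸ (β (both js f) ℕ.+ met js f))))
    ≗ L (sparseTerm js g f x)
  pointwise x rewrite sparse-both s | met-∪ js x f
    | ℕ.+-∸-assoc 1 {ν js x f ℕ.+ met js f} {met js f} (ℕ.m≤n+m (met js f) (ν js x f)) | ℕ.m+n∸n≡m (ν js x f) (met js f)
    with both js (x ∪ f)
  ... | true  rewrite ℕ.+-∸-assoc 1 {ν js x f ℕ.+ met js f} {met js f} (ℕ.m≤n+m (met js f) (ν js x f)) | ℕ.m+n∸n≡m (ν js x f) (met js f)
      | ∧-zeroʳ (subsetᵇ x (g ─ f)) = cancel (subsetᵇ x (g ─ f)) (sign ∣ x ∣) (tpow (ν js x f))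
  ... | false rewrite ℕ.m+n∸n≡m (ν js x f) (met js f) | ∧-identityʳ (subsetᵇ x (g ─ f)) =
    edge-L (subsetᵇ x (g ─ f)) (sign ∣ x ∣) (tpow (ν js x f))

subset-─-∪ : ∀ {m} (x g f : Subset m) → subsetᵇ x (g ─ f) ≡ true → subsetᵇ f g ≡ true → subsetᵇ (x ∪ f) g ≡ true
subset-─-∪ []          []          []          e h = refl
subset-─-∪ (true ∷ x)  (true ∷ g)  (false ∷ f) e h = subset-─-∪ x g f e h
subset-─-∪ (false ∷ x) (true ∷ g)  (true ∷ f)  e h = subset-─-∪ x g f e h
subset-─-∪ (false ∷ x) (true ∷ g)  (false ∷ f) e h = subset-─-∪ x g f e h
subset-─-∪ (false ∷ x) (false ∷ g) (false ∷ f) e h = subset-─-∪ x g f e h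

charSum-sparse : ∀ {js g} → Sparse js g → ∀ f → subsetᵇ f g ≡ true →
                 charSum (contract (Mat js (false ∷ g)) (false ∷ f)) ≗ freeSum js g f
charSum-sparse {js} {g} s f h = sumS-cong (#edges js) λ x → (λ i → ℤ.+-identityʳ _) ∙ ◂-cong (subsetᵇ x (g ─ f)) λ e i →
  cong (λ a → (sign ∣ x ∣ ⊙ tpow a) i)
    (trans (cong₂ (λ a b → (β a ℕ.+ met js (x ∪ f)) ∸ (β b ℕ.+ met js f))
              (sparse-both (sparse-subset s (x ∪ f) (subset-─-∪ x g f e h))) (sparse-both (sparse-subset s f h)))
           (ν-∸ js x f))

-- Sums over flats

-- Each of n spikes, or single edges, lies outside the flat (counted by the first argument of `h`)
-- or meets it (counted by the second). `Split` gives Σ C(n,b) h(n-b,b). `Split₂` weights this by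
-- 2^b, for the choice between the two edges of a spike.
Split Split₂ : ℕ → (ℕ → ℕ → Seq) → Seq
Split zero    h = h 0 0
Split (suc n) h = Split n (λ a b → h (suc a) b) ⊞ Split n (λ a b → h a (suc b))
Split₂ zero    h = h 0 0
Split₂ (suc n) h = Split₂ n (λ a b → h (suc a) b) ⊞ (Split₂ n (λ a b → h a (suc b)) ⊞ Split₂ n (λ a b → h a (suc b)))

Split-cong : ∀ n {h k} → (∀ a b → h a b ≗ k a b) → Split n h ≗ Split n k
Split-cong zero    p = p 0 0
Split-cong (suc n) p = ⊞-cong (Split-cong n (λ a b → p (suc a) b)) (Split-cong n (λ a b → p a (suc b)))

Split₂-cong : ∀ n {h k} → (∀ a b → h a b ≗ k a b) → Split₂ n h ≗ Split₂ n k
Split₂-cong zero    p = p 0 0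
Split₂-cong (suc n) p =
  ⊞-cong (Split₂-cong n (λ a b → p (suc a) b)) (⊞-cong (Split₂-cong n (λ a b → p a (suc b))) (Split₂-cong n (λ a b → p a (suc b))))

Split-Bin : ∀ {F} → Linear F → ∀ n g → Split n (λ a b → iter F a (g b)) ≗ Bin F n g
Split-Bin l zero    g = refl≗
Split-Bin {F} l (suc n) g =
  ⊞-cong (Split-cong n (λ a b i → cong (λ f → f i) (iter-inner F a (g b))) ∙ Split-Bin l n (F ∘ g)) (Split-Bin l n (g ∘ suc))

Split-sign : ∀ n g → Split n (λ a b → sign b ⊙ iter L a (g b)) ≗ sign n ⊙ Bin L⁻ n g
Split-sign n g =
  Split-cong n (λ a b → sym≗ (scl (iter-linear L-linear a) (sign b) (g b)))
  ∙ Split-Bin L-linear n (λ b → sign b ⊙ g b) ∙ Bin-sign n g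

-- The origin of (1+2t)^n: each spike contributes (1 - 2t) - 2 = -(1 + 2t).
Split₂-sign : ∀ n p → Split₂ n (λ a b → sign b ⊙ iter K a p) ≗ sign n ⊙ iter (op (+ 1) (+ 2)) n p
Split₂-sign zero    p = refl≗
Split₂-sign (suc n) p =
  ⊞-cong (Split₂-cong n (λ a b i → cong (λ f → sign b ℤ.* f i) (iter-inner K a p)) ∙ Split₂-sign n (K p))
         (⊞-cong taken taken)
  ∙ (λ i → eq₁ (sign n) (iter O n (K p) i) (iter O n ((- + 1) ⊙ p) i))
  ∙ ⊙-cong (sign n) (⊞-cong {f = iter O n (K p)} refl≗ (sym≗ (scl lo (+ 2) ((- + 1) ⊙ p)))
                     ∙ sym≗ (add lo (K p) (+ 2 ⊙ (- + 1) ⊙ p))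
                     ∙ resp lo (λ i → eq₂ (p i) (shift p i))
                     ∙ scl lo (- + 1) (O p))
  ∙ (λ i → eq₃ (sign n) (iter O n (O p) i))
  ∙ λ i → cong (λ f → - sign n ℤ.* f i) (sym (iter-inner O n p))
  where
  O = op (+ 1) (+ 2)
  lo = iter-linear (op-linear (+ 1) (+ 2)) n
  eq₀ : ∀ s x → - s ℤ.* x ≡ s ℤ.* (- + 1 ℤ.* x)
  eq₀ = ring
  taken : Split₂ n (λ a b → sign (suc b) ⊙ iter K a p) ≗ sign n ⊙ iter O n ((- + 1) ⊙ p)
  taken = Split₂-cong n (λ a b → (λ i → eq₀ (sign b) (iter K a p i))
                                 ∙ ⊙-cong (sign b) (sym≗ (scl (iter-linear K-linear a) (- + 1) p)))
          ∙ Split₂-sign n ((- + 1) ⊙ p)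
  eq₁ : ∀ s x y → s ℤ.* x ℤ.+ (s ℤ.* y ℤ.+ s ℤ.* y) ≡ s ℤ.* (x ℤ.+ + 2 ℤ.* y)
  eq₁ = ring
  eq₂ : ∀ x y → (+ 1 ℤ.* x ℤ.+ - + 2 ℤ.* y) ℤ.+ + 2 ℤ.* (- + 1 ℤ.* x) ≡ - + 1 ℤ.* (+ 1 ℤ.* x ℤ.+ + 2 ℤ.* y)
  eq₂ = ring
  eq₃ : ∀ s x → s ℤ.* (- + 1 ℤ.* x) ≡ - s ℤ.* x
  eq₃ = ring

sum-pure : ∀ {js g} → Pure js g → ∀ h → sumS (#edges js) (λ f → pureIn js g f ◂ h (ν js g f) (met js f)) ≗ Split (met js g) h
sum-pure []      h = refl≗
sum-pure {j ∷ js} {_ ∷ _ ∷ g} (off p) h =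
  sumS-cong (#edges js) (λ f → only₁ (pureIn js g f ◂ h (ν js g f) (met js f))) ∙ sum-pure p h
sum-pure {j ∷ js} {_ ∷ _ ∷ g} (on p)  h =
  sumS-cong (#edges js) (λ f → outer₂ (pureIn js g f ◂ h (suc (ν js g f)) (met js f)) (pureIn js g f ◂ h (ν js g f) (suc (met js f))))
  ∙ sumS-add (#edges js) _ _
  ∙ ⊞-cong (sum-pure p (λ a b → h (suc a) b)) (sum-pure p (λ a b → h a (suc b)))

sum-sparseIn : ∀ {js g} → Pure js g → ∀ h → sumS (#edges js) (λ f → sparseIn js g f ◂ h (ν js g f) (met js f)) ≗ Split₂ (met js g) h
sum-sparseIn []      h = refl≗
sum-sparseIn {j ∷ js} {_ ∷ _ ∷ g} (off p) h =
  sumS-cong (#edges js) (λ f → only₁ (sparseIn js g f ◂ h (ν js g f) (met js f))) ∙ sum-sparseIn p h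
sum-sparseIn {j ∷ js} {_ ∷ _ ∷ g} (on p)  h =
  sumS-cong (#edges js) (λ f i → eq ((sparseIn js g f ◂ h (suc (ν js g f)) (met js f)) i) ((sparseIn js g f ◂ h (ν js g f) (suc (met js f))) i))
  ∙ sumS-add (#edges js) _ _
  ∙ ⊞-cong (sum-sparseIn p (λ a b → h (suc a) b))
           (sumS-add (#edges js) _ _ ∙ ⊞-cong (sum-sparseIn p (λ a b → h a (suc b))) (sum-sparseIn p (λ a b → h a (suc b))))
  where
  eq : ∀ x y → (x ℤ.+ y) ℤ.+ (y ℤ.+ + 0) ≡ x ℤ.+ (y ℤ.+ y)
  eq = ring

sum-sparse : ∀ {js g} → Sparse js g → ∀ h → sumS (#edges js) (λ f → subsetᵇ f g ◂ h (ν js g f) (met js f)) ≗ Split (met js g) h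
sum-sparse []        h = refl≗
sum-sparse {j ∷ js} {_ ∷ _ ∷ g} (none s)  h =
  sumS-cong (#edges js) (λ f → only₁ (subsetᵇ f g ◂ h (ν js g f) (met js f))) ∙ sum-sparse s h
sum-sparse {j ∷ js} {_ ∷ _ ∷ g} (left s)  h =
  sumS-cong (#edges js) (λ f i → ℤ.+-identityʳ _)
  ∙ sumS-add (#edges js) _ _
  ∙ ⊞-cong (sum-sparse s (λ a b → h (suc a) b)) (sum-sparse s (λ a b → h a (suc b)))
sum-sparse {j ∷ js} {_ ∷ _ ∷ g} (right s) h =
  sumS-cong (#edges js) (λ f → even₂ (subsetᵇ f g ◂ h (suc (ν js g f)) (met js f)) (subsetᵇ f g ◂ h (ν js g f) (suc (met js f))))
  ∙ sumS-add (#edges js) _ _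
  ∙ ⊞-cong (sum-sparse s (λ a b → h (suc a) b)) (sum-sparse s (λ a b → h a (suc b)))

-- The polynomials of the restrictions

sparse-< : ∀ {js g} → Sparse js g → ∀ f → subsetᵇ f g ≡ true → eqᵇ f g ≡ false → met js f < met js g
sparse-< []        []                  h ()
sparse-< (none s)  (false ∷ false ∷ f) h e = sparse-< s f h e
sparse-< (left s)  (true ∷ false ∷ f)  h e = s≤s (sparse-< s f h e)
sparse-< {j ∷ js} {_ ∷ _ ∷ g} (left s)  (false ∷ false ∷ f) h e = s≤s (met-mono js f g h)
sparse-< (right s) (false ∷ true ∷ f)  h e = s≤s (sparse-< s f h e)
sparse-< {j ∷ js} {_ ∷ _ ∷ g} (right s) (false ∷ false ∷ f) h e = s≤s (met-mono js f g h)

-- On a constant sequence E is the identity, so (t - 1) + E is multiplication by t.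
Bin-const : ∀ n f → Bin L⁻ n (λ _ → f) ≗ iter shift n f
Bin-const zero    f = refl≗
Bin-const (suc n) f =
  ⊞-cong (Bin-const n (L⁻ f)) (Bin-const n f)
  ∙ sym≗ (add (iter-linear shift-linear n) (L⁻ f) f)
  ∙ resp (iter-linear shift-linear n) (λ i → eq (f i) (shift f i))
  ∙ λ i → cong (λ h → h i) (sym (iter-inner shift n f))
  where
  eq : ∀ x y → (- + 1 ℤ.* x ℤ.+ + 1 ℤ.* y) ℤ.+ x ≡ y
  eq = ring

iter-shift : ∀ n → iter shift n (tpow 0) ≡ tpow n
iter-shift zero    = refl
iter-shift (suc n) = cong shift (iter-shift n)

sign-square : ∀ n → sign n ℤ.* sign n ≡ + 1
sign-square zero    = refl
sign-square (suc n) = trans (eq (sign n)) (sign-square n)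
  where
  eq : ∀ s → - s ℤ.* - s ≡ s ℤ.* s
  eq = ring

recipChar : ∀ js → Subset (suc (#edges js)) → Subset (suc (#edges js)) → Poly
recipChar js G F = recip (rank (contract (Mat js G) F)) (charPoly (contract (Mat js G) F))

module SparseStep {js g} (s : Sparse js g) (k r : ℕ) (met≡ : met js g ≡ suc r)
  (ih : ∀ {f} → Sparse js f → met js f ≤ k → coeff (invKLaux k (Mat js (false ∷ f))) ≗ tpow 0)
  (fuel : met js g ≤ suc k) where

  M : Matroid
  M = Mat js (false ∷ g)

  val : Subset (suc (#edges js)) → Seq
  -- A default: the ground set omits AB, so no flat contains it.
  val (true ∷ f)  = 0S
  val (false ∷ f) = sign (met js f) ⊙ iter L (ν js g f) (tpow 0)

  rank≡ : rank M ≡ suc r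
  rank≡ = trans (cong (λ b → β b ℕ.+ met js g) (sparse-both s)) met≡

  val-flat : ∀ F → isFlat M F ≡ true → eqᵇ F (false ∷ g) ≡ false →
    sign (ρ js F) ⊙ conv (coeff (invKLaux k (Mat js F))) (coeff (recipChar js (false ∷ g) F)) ≗ val F
  val-flat (false ∷ f) h e =
    (λ i → cong (λ b → sign (β b ℕ.+ met js f) ℤ.* conv (coeff (invKLaux k (Mat js (false ∷ f)))) (coeff (recipChar js (false ∷ g) (false ∷ f))) i) (sparse-both sf))
    ∙ ⊙-cong (sign (met js f))
        (conv-cong (ih sf (ℕ.≤-pred (ℕ.≤-trans (sparse-< s f f⊆g e) fuel)))
                   (recip-char js (false ∷ g) (false ∷ f) ∙ charSum-sparse s f f⊆g ∙ freeSum-sparse s f f⊆g)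
         ∙ conv-tpow0ˡ (iter L (ν js g f) (tpow 0)))
    where
    f⊆g : subsetᵇ f g ≡ true
    f⊆g = trans (sym (isFlat-sparse s f)) h
    sf = sparse-subset s f f⊆g

  ground-flat : isFlat M (false ∷ g) ≡ true
  ground-flat = trans (isFlat-sparse s g) (subset-refl g)

  total : sumS (suc (#edges js)) (λ F → isFlat M F ◂ val F) ≗ sign (met js g) ⊙ tpow (met js g)
  total =
    sumS-cong (#edges js) (λ f i → trans (ℤ.+-identityʳ _) (cong (λ b → (b ◂ val (false ∷ f)) i) (isFlat-sparse s f)))
    ∙ sum-sparse s (λ a b → sign b ⊙ iter L a (tpow 0))
    ∙ Split-sign (met js g) (λ _ → tpow 0)
    ∙ ⊙-cong (sign (met js g)) (Bin-const (met js g) (tpow 0) ∙ λ i → cong (λ f → f i) (iter-shift (met js g)))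

  result : coeff (invKLaux (suc k) M) ≗ tpow 0
  result i with 2 ℕ.* i ℕ.<? suc r
  ... | no ¬l = trans (invKLaux-high k M r rank≡ val val-flat ground-flat i ¬l) (sym (tpow-≢ 0 i λ { refl → ¬l (s≤s z≤n) }))
  ... | yes l = begin
    coeff (invKLaux (suc k) M) i
      ≡⟨ invKLaux-low k M r rank≡ val val-flat ground-flat i l ⟩
    sign r ℤ.* (sumS (suc (#edges js)) (λ F → isFlat M F ◂ val F) i ℤ.- val (false ∷ g) i)
      ≡⟨ cong₂ (λ x n → sign r ℤ.* (x ℤ.- sign (met js g) ℤ.* iter L n (tpow 0) i)) (total i) (ν-self js g) ⟩
    sign r ℤ.* (sign (met js g) ℤ.* tpow (met js g) i ℤ.- sign (met js g) ℤ.* tpow 0 i)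
      ≡⟨ cong (λ n → sign r ℤ.* (sign n ℤ.* tpow n i ℤ.- sign n ℤ.* tpow 0 i)) met≡ ⟩
    sign r ℤ.* (- sign r ℤ.* tpow (suc r) i ℤ.- - sign r ℤ.* tpow 0 i)
      -- The sum over all flats is ± t^{r+1}, invisible in degrees below (r+1)/2; only the
      -- subtracted ground term survives, and it gives 1.
      ≡⟨ cong (λ x → sign r ℤ.* (- sign r ℤ.* x ℤ.- - sign r ℤ.* tpow 0 i))
           (tpow-≢ (suc r) i λ { refl → ℕ.<⇒≱ l (ℕ.m≤m+n (suc r) _) }) ⟩
    sign r ℤ.* (- sign r ℤ.* + 0 ℤ.- - sign r ℤ.* tpow 0 i)
      ≡⟨ eq (sign r) (tpow 0 i) ⟩
    (sign r ℤ.* sign r) ℤ.* tpow 0 i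
      ≡⟨ cong (ℤ._* tpow 0 i) (sign-square r) ⟩
    + 1 ℤ.* tpow 0 i
      ≡⟨ ℤ.*-identityˡ (tpow 0 i) ⟩
    tpow 0 i ∎
    where
    open ≡-Reasoning
    eq : ∀ s x → s ℤ.* (- s ℤ.* + 0 ℤ.- - s ℤ.* x) ≡ (s ℤ.* s) ℤ.* x
    eq = ring

-- The number of edges present suffices as fuel: proper flats have fewer, and with none left the
-- rank is zero, where the answer is 1 even without fuel.
invKL-sparse : ∀ k {js g} → Sparse js g → met js g ≤ k → coeff (invKLaux k (Mat js (false ∷ g))) ≗ tpow 0
invKL-sparse k {js} {g} s p with met js g in e
... | zero = invKLaux-rank0 k (Mat js (false ∷ g)) (trans (cong (λ b → β b ℕ.+ met js g) (sparse-both s)) e)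
invKL-sparse (suc k) {js} {g} s p | suc r =
  SparseStep.result s k r e (invKL-sparse k) (subst (_≤ suc k) (sym e) p)

module PureStep {js g} (p : Pure js g) (k : ℕ)
  (ih : ∀ {f} → Pure js f → met js f < k → coeff (invKLaux k (Mat js (true ∷ f))) ≗ qS (met js f))
  (fuel : met js g ≤ k) where

  n : ℕ
  n = met js g

  M : Matroid
  M = Mat js (true ∷ g)

  -- Writing s for `met js f`, a flat with AB has restriction polynomial Q_s and reversed
  -- characteristic polynomial (1-t)^{n-s}; a flat without AB has 1 and (1-t)(1-2t)^{n-s}. On flats,
  -- n - s is `ν js g f`.
  val : Subset (suc (#edges js)) → Seq
  val (true ∷ f)  = sign (suc (met js f)) ⊙ iter L (ν js g f) (qS (met js f))
  val (false ∷ f) = sign (met js f) ⊙ L (iter K (ν js g f) (tpow 0))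

  val-flat : ∀ F → isFlat M F ≡ true → eqᵇ F (true ∷ g) ≡ false →
    sign (ρ js F) ⊙ conv (coeff (invKLaux k (Mat js F))) (coeff (recipChar js (true ∷ g) F)) ≗ val F
  val-flat (true ∷ f) h e =
    ⊙-cong (sign (suc (met js f)))
      (conv-cong (ih (pureIn-pure p f f≤g) (ℕ.<-≤-trans (pureIn-< p f f≤g e) fuel))
                 (recip-char js (true ∷ g) (true ∷ f) ∙ charSum-AB js g f ∙ freeSum-pure p f f≤g)
       ∙ conv-iter (qS (met js f)) (+ 1) (- + 1) (ν js g f) (tpow 0)
       ∙ resp (iter-linear L-linear (ν js g f)) (conv-tpow0ʳ (qS (met js f))))
    where
    f≤g : pureIn js g f ≡ true
    f≤g = trans (sym (isFlat-AB p f)) h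
  val-flat (false ∷ f) h e =
    (λ i → cong (λ b → sign (β b ℕ.+ met js f) ℤ.* conv (coeff (invKLaux k (Mat js (false ∷ f)))) (coeff (recipChar js (true ∷ g) (false ∷ f))) i) (sparse-both sf))
    ∙ ⊙-cong (sign (met js f))
        (conv-cong (invKL-sparse k sf (ℕ.≤-trans (sparseIn-≤ p f f≤g) fuel))
                   (recip-char js (true ∷ g) (false ∷ f) ∙ charSum-noAB g sf ∙ resp L-linear (sparseSum-pure p f f≤g))
         ∙ conv-tpow0ˡ (L (iter K (ν js g f) (tpow 0))))
    where
    f≤g : sparseIn js g f ≡ true
    f≤g = trans (sym (isFlat-noAB p f)) h
    sf = sparseIn-sparse p f f≤g

  ground-flat : isFlat M (true ∷ g) ≡ true
  ground-flat = trans (isFlat-AB p g) (pureIn-refl p)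

  O : Seq → Seq
  O = op (+ 1) (+ 2)

  total-noAB : sumS (#edges js) (λ f → isFlat M (false ∷ f) ◂ val (false ∷ f)) ≗ L (sign n ⊙ iter O n (tpow 0))
  total-noAB =
    sumS-cong (#edges js) (λ f → (λ i → cong (λ b → (b ◂ val (false ∷ f)) i) (isFlat-noAB p f))
      ∙ resp (◂-linear (sparseIn js g f)) (sym≗ (scl L-linear (sign (met js f)) (iter K (ν js g f) (tpow 0))))
      ∙ sym≗ (◂-commute (sparseIn js g f) L-linear (sign (met js f) ⊙ iter K (ν js g f) (tpow 0))))
    ∙ sym≗ (sumS-linear L-linear (#edges js) (λ f → sparseIn js g f ◂ (sign (met js f) ⊙ iter K (ν js g f) (tpow 0))))
    ∙ resp L-linear (sum-sparseIn p (λ a b → sign b ⊙ iter K a (tpow 0)) ∙ Split₂-sign n (tpow 0))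

  total-AB : sumS (#edges js) (λ f → isFlat M (true ∷ f) ◂ val (true ∷ f)) ≗ sign n ⊙ (- + 1) ⊙ Bin L⁻ n qS
  total-AB =
    sumS-cong (#edges js) (λ f i → cong (λ b → (b ◂ val (true ∷ f)) i) (isFlat-AB p f))
    ∙ sum-pure p (λ a b → sign (suc b) ⊙ iter L a (qS b))
    ∙ Split-cong n (λ a b → (λ i → eq (sign b) (iter L a (qS b) i))
                            ∙ ⊙-cong (sign b) (sym≗ (scl (iter-linear L-linear a) (- + 1) (qS b))))
    ∙ Split-sign n (λ b → (- + 1) ⊙ qS b)
    ∙ ⊙-cong (sign n) (sym≗ (Bin-commute ll⁻ (⊙-linear (- + 1)) (λ f → sym≗ (scl ll⁻ (- + 1) f)) n qS))
    where
    ll⁻ = op-linear (- + 1) (+ 1)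
    eq : ∀ s x → - s ℤ.* x ≡ s ℤ.* (- + 1 ℤ.* x)
    eq = ring

  result : coeff (invKLaux (suc k) M) ≗ qS n
  result i with 2 ℕ.* i ℕ.<? suc n
  ... | no ¬l = trans (invKLaux-high k M n refl val val-flat ground-flat i ¬l) (sym (qS-high n i (ℕ.≮⇒≥ ¬l)))
  ... | yes l = begin
    coeff (invKLaux (suc k) M) i
      ≡⟨ invKLaux-low k M n refl val val-flat ground-flat i l ⟩
    sign n ℤ.* (sumS (suc (#edges js)) (λ F → isFlat M F ◂ val F) i ℤ.- val (true ∷ g) i)
      ≡⟨ cong₂ (λ x a → sign n ℤ.* (x ℤ.- sign (suc n) ℤ.* iter L a (qS n) i))
           (trans (sumS-add (#edges js) (λ f → isFlat M (false ∷ f) ◂ val (false ∷ f)) (λ f → isFlat M (true ∷ f) ◂ val (true ∷ f)) i)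
                  (cong₂ ℤ._+_ (trans (total-noAB i) (scl L-linear (sign n) (iter O n (tpow 0)) i)) (total-AB i)))
           (ν-self js g) ⟩
    sign n ℤ.* ((sign n ℤ.* X ℤ.+ sign n ℤ.* (- + 1 ℤ.* Bin L⁻ n qS i)) ℤ.- - sign n ℤ.* qS n i)
      -- By the low half of the identity the two families of flats cancel, again leaving only the
      -- ground term.
      ≡⟨ cong (λ x → sign n ℤ.* ((sign n ℤ.* X ℤ.+ sign n ℤ.* (- + 1 ℤ.* x)) ℤ.- - sign n ℤ.* qS n i))
           (qS-identity n i (ℕ.≤-pred l)) ⟩
    sign n ℤ.* ((sign n ℤ.* X ℤ.+ sign n ℤ.* (- + 1 ℤ.* X)) ℤ.- - sign n ℤ.* qS n i)
      ≡⟨ eq (sign n) X (qS n i) ⟩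
    (sign n ℤ.* sign n) ℤ.* qS n i
      ≡⟨ cong (ℤ._* qS n i) (sign-square n) ⟩
    + 1 ℤ.* qS n i
      ≡⟨ ℤ.*-identityˡ (qS n i) ⟩
    qS n i ∎
    where
    open ≡-Reasoning
    X = L (iter O n (tpow 0)) i
    eq : ∀ s x q → s ℤ.* ((s ℤ.* x ℤ.+ s ℤ.* (- + 1 ℤ.* x)) ℤ.- - s ℤ.* q) ≡ (s ℤ.* s) ℤ.* q
    eq = ring

invKL-pure : ∀ k {js g} → Pure js g → met js g < k → coeff (invKLaux k (Mat js (true ∷ g))) ≗ qS (met js g)
invKL-pure (suc k) p (s≤s q) = PureStep.result p k (invKL-pure k) q

-- The rank function of K_{1,1,n}

merge-hit : ∀ ℓ u w v → ℓ v ≡ ℓ w → mergeEdge ℓ (u , w) v ≡ ℓ u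
merge-hit ℓ u w v e with ℓ v ≡ᵇ ℓ w | ℕ.≡⇒≡ᵇ (ℓ v) (ℓ w) e
... | true | _ = refl

merge-miss : ∀ ℓ u w v → ℓ v ≢ ℓ w → mergeEdge ℓ (u , w) v ≡ ℓ v
merge-miss ℓ u w v e with ℓ v ≡ᵇ ℓ w in q
... | false = refl
... | true  = contradiction (ℕ.≡ᵇ⇒≡ (ℓ v) (ℓ w) (subst T (sym q) _)) e

-- Whether A and B have been merged; the common label may be either of them.
Roots : Labels → Bool → Set
Roots ℓ false = ℓ 0 ≡ 0 × ℓ 1 ≡ 1
Roots ℓ true  = ℓ 0 ≡ ℓ 1 × ℓ 0 < 2

-- For an outer vertex: it has joined A or B, or it still has its own label. Only the bound is
-- recorded in the first case, because later merges may change label 0 into 1.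
Touched : Labels → ℕ → Bool → Set
Touched ℓ v true  = ℓ v < 2
Touched ℓ v false = ℓ v ≡ v

roots-0 : ∀ {ℓ} b → Roots ℓ b → ℓ 0 < 2
roots-0 false (p , q) = subst (_< 2) (sym p) (s≤s z≤n)
roots-0 true  (p , q) = q

roots-1 : ∀ {ℓ} b → Roots ℓ b → ℓ 1 < 2
roots-1 false (p , q) = subst (_< 2) (sym q) (s≤s (s≤s z≤n))
roots-1 true  (p , q) = subst (_< 2) p q

roots-resp : ∀ {ℓ ℓ′} b → ℓ′ 0 ≡ ℓ 0 → ℓ′ 1 ≡ ℓ 1 → Roots ℓ b → Roots ℓ′ b
roots-resp false e f (p , q) = trans e p , trans f q
roots-resp true  e f (p , q) = trans e (trans p (sym f)) , subst (_< 2) (sym e) q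

Persists : Labels → Labels → ℕ → Set
Persists ℓ ℓ′ v = ∀ s → Touched ℓ v s → Touched ℓ′ v s

<2≢ : ∀ {x y} → x < 2 → 2 ≤ y → x ≢ y
<2≢ p q refl = ℕ.<⇒≱ p q

-- The first edge used at an outer vertex `w`: only vertices labelled `w` are relabelled, so A, B
-- and everything attached to them keep their labels.
module Fresh (ℓ : Labels) (u w : ℕ) (2≤w : 2 ≤ w) (fresh : ℓ w ≡ w) where

  ℓ′ : Labels
  ℓ′ = mergeEdge ℓ (u , w)

  low : ∀ v → ℓ v < 2 → ℓ′ v ≡ ℓ v
  low v p = merge-miss ℓ u w v (<2≢ p (subst (2 ≤_) (sym fresh) 2≤w))

  new : ℓ′ w ≡ ℓ u
  new = merge-hit ℓ u w w refl

  roots : ∀ b → Roots ℓ b → Roots ℓ′ b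
  roots b r = roots-resp b (low 0 (roots-0 b r)) (low 1 (roots-1 b r)) r

  persists : ∀ v → v ≢ w → Persists ℓ ℓ′ v
  persists v v≢w true  p = subst (_< 2) (sym (low v p)) p
  persists v v≢w false p = trans (merge-miss ℓ u w v (λ q → v≢w (trans (sym p) (trans q fresh)))) p

-- The second edge of a spike: `w` already has the label of A, so the class of A takes over the
-- label of B.
module Closing (ℓ : Labels) (w : ℕ) (at0 : ℓ w ≡ ℓ 0) (r₀ : ℓ 0 < 2) (r₁ : ℓ 1 < 2) where

  ℓ′ : Labels
  ℓ′ = mergeEdge ℓ (1 , w)

  low : ∀ v → ℓ v < 2 → ℓ′ v < 2
  low v p with ℓ v ℕ.≟ ℓ w
  ... | yes q = subst (_< 2) (sym (merge-hit ℓ 1 w v q)) r₁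
  ... | no  q = subst (_< 2) (sym (merge-miss ℓ 1 w v q)) p

  roots : Roots ℓ′ true
  roots = trans e₀ (sym e₁) , subst (_< 2) (sym e₀) r₁
    where
    e₀ : ℓ′ 0 ≡ ℓ 1
    e₀ = merge-hit ℓ 1 w 0 (sym at0)
    e₁ : ℓ′ 1 ≡ ℓ 1
    e₁ with ℓ 1 ℕ.≟ ℓ w
    ... | yes q = merge-hit ℓ 1 w 1 q
    ... | no  q = merge-miss ℓ 1 w 1 q

  persists : ∀ v → 2 ≤ v → Persists ℓ ℓ′ v
  persists v 2≤v true  p = low v p
  persists v 2≤v false p =
    trans (merge-miss ℓ 1 w v (λ q → <2≢ r₀ 2≤v (trans (sym at0) (trans (sym q) p)))) p

selected : ∀ js → Spikes js → List (ℕ × ℕ)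
selected js = selectEdges (Vec.fromList (concatMap spike js))

spikeLabels : Labels → ℕ → Bool → Bool → Labels
spikeLabels ℓ j a c = List.foldl mergeEdge ℓ (selected (j ∷ []) (a ∷ c ∷ []))

selected-step : ∀ ℓ j js a c x →
  List.foldl mergeEdge ℓ (selected (j ∷ js) (a ∷ c ∷ x)) ≡ List.foldl mergeEdge (spikeLabels ℓ j a c) (selected js x)
selected-step ℓ j js true  true  x = refl
selected-step ℓ j js true  false x = refl
selected-step ℓ j js false true  x = refl
selected-step ℓ j js false false x = refl

spike-step : ∀ ℓ b j a c → Roots ℓ b → 2 ≤ suc j → ℓ (suc j) ≡ suc j → let ℓ′ = spikeLabels ℓ j a c in
  Roots ℓ′ (b ∨ (a ∧ c)) × Touched ℓ′ (suc j) (a ∨ c) × (∀ v → 2 ≤ v → v ≢ suc j → Persists ℓ ℓ′ v)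
spike-step ℓ b j false false r 2≤w e = subst (Roots ℓ) (sym (∨-identityʳ b)) r , e , λ v _ _ s p → p
spike-step ℓ b j true false r 2≤w e =
  subst (Roots F.ℓ′) (sym (∨-identityʳ b)) (F.roots b r) , subst (_< 2) (sym F.new) (roots-0 b r) , λ v _ → F.persists v
  where module F = Fresh ℓ 0 (suc j) 2≤w e
spike-step ℓ b j false true r 2≤w e =
  subst (Roots F.ℓ′) (sym (∨-identityʳ b)) (F.roots b r) , subst (_< 2) (sym F.new) (roots-1 b r) , λ v _ → F.persists v
  where module F = Fresh ℓ 1 (suc j) 2≤w e
spike-step ℓ b j true true r 2≤w e =
  subst (Roots C.ℓ′) (sym (∨-zeroʳ b)) C.roots
  , C.low (suc j) (subst (_< 2) (sym F.new) (roots-0 b r))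
  , λ v 2≤v v≢w s p → C.persists v 2≤v s (F.persists v v≢w s p)
  where
  module F = Fresh ℓ 0 (suc j) 2≤w e
  r′ = F.roots b r
  module C = Closing F.ℓ′ (suc j) (trans F.new (sym (F.low 0 (roots-0 b r)))) (roots-0 b r′) (roots-1 b r′)

fixed : Labels → List ℕ → ℕ
fixed ℓ vs = length (filter (λ v → v ℕ.≟ ℓ v) vs)

fixed-yes : ∀ ℓ v vs → v ≡ ℓ v → fixed ℓ (v ∷ vs) ≡ suc (fixed ℓ vs)
fixed-yes ℓ v vs p = cong length (List.filter-accept (λ v → v ℕ.≟ ℓ v) p)

fixed-no : ∀ ℓ v vs → v ≢ ℓ v → fixed ℓ (v ∷ vs) ≡ fixed ℓ vs
fixed-no ℓ v vs p = cong length (List.filter-reject (λ v → v ℕ.≟ ℓ v) p)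

fixed-touched : ∀ ℓ v vs s → 2 ≤ v → Touched ℓ v s → fixed ℓ (v ∷ vs) ℕ.+ β s ≡ suc (fixed ℓ vs)
fixed-touched ℓ v vs true  2≤v p = trans (cong (ℕ._+ 1) (fixed-no ℓ v vs (λ q → <2≢ p 2≤v (sym q)))) (ℕ.+-comm _ 1)
fixed-touched ℓ v vs false 2≤v p = trans (ℕ.+-identityʳ _) (fixed-yes ℓ v vs (sym p))

-- Once A and B are merged, exactly one of them keeps its own label, whichever that is.
fixed-roots : ∀ ℓ b vs → Roots ℓ b → fixed ℓ (0 ∷ 1 ∷ vs) ℕ.+ β b ≡ 2 ℕ.+ fixed ℓ vs
fixed-roots ℓ false vs (p , q) =
  trans (ℕ.+-identityʳ _) (trans (fixed-yes ℓ 0 (1 ∷ vs) (sym p)) (cong suc (fixed-yes ℓ 1 vs (sym q))))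
fixed-roots ℓ true vs (p , q) = trans (ℕ.+-comm (fixed ℓ (0 ∷ 1 ∷ vs)) 1) (cong suc (one (ℓ 0) refl q))
  where
  one : ∀ k → ℓ 0 ≡ k → k < 2 → fixed ℓ (0 ∷ 1 ∷ vs) ≡ suc (fixed ℓ vs)
  one zero          e _ = trans (fixed-yes ℓ 0 (1 ∷ vs) (sym e))
    (cong suc (fixed-no ℓ 1 vs λ h → contradiction (trans h (trans (sym p) e)) λ ()))
  one (suc zero)    e _ = trans (fixed-no ℓ 0 (1 ∷ vs) λ h → contradiction (trans h e) λ ())
    (fixed-yes ℓ 1 vs (trans (sym e) p))
  one (suc (suc _)) e (s≤s (s≤s ()))

-- The invariant of the merging process. The middle clause says that vertices of other spikes keep
-- their status; it lets the count for one spike survive the processing of all later ones.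
spikes-run : ∀ js x ℓ b → Unique js → All (1 ≤_) js → All (λ j → ℓ (suc j) ≡ suc j) js → Roots ℓ b →
  let ℓ′ = List.foldl mergeEdge ℓ (selected js x) in
  Roots ℓ′ (b ∨ both js x)
  × (∀ v → 2 ≤ v → All (λ j → v ≢ suc j) js → Persists ℓ ℓ′ v)
  × fixed ℓ′ (map suc js) ℕ.+ met js x ≡ length js
spikes-run []       []          ℓ b _ _ _ r = subst (Roots ℓ) (sym (∨-identityʳ b)) r , (λ v _ _ s p → p) , refl
spikes-run (j ∷ js) (a ∷ c ∷ x) ℓ b (u ∷ us) (o ∷ os) (e ∷ es) r
  rewrite selected-step ℓ j js a c x | sym (∨-assoc b (a ∧ c) (both js x)) =
  R , (λ { v 2≤v (v≢ ∷ v≢s) s p → P v 2≤v v≢s s (P₁ v 2≤v v≢ s p) }) , count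
  where
  ℓ₁ = spikeLabels ℓ j a c
  ℓ′ = List.foldl mergeEdge ℓ₁ (selected js x)
  head = spike-step ℓ b j a c r (s≤s o) e
  P₁ = proj₂ (proj₂ head)
  fresh : ∀ {js} → All (j ≢_) js → All (1 ≤_) js → All (λ j → ℓ (suc j) ≡ suc j) js → All (λ j → ℓ₁ (suc j) ≡ suc j) js
  fresh []       []       []       = []
  fresh (u ∷ us) (o ∷ os) (e ∷ es) = P₁ _ (s≤s o) (λ q → u (sym (ℕ.suc-injective q))) false e ∷ fresh us os es
  tail = spikes-run js x ℓ₁ (b ∨ (a ∧ c)) us os (fresh u os es) (proj₁ head)
  R = proj₁ tail
  P = proj₁ (proj₂ tail)
  open ≡-Reasoning
  count : fixed ℓ′ (map suc (j ∷ js)) ℕ.+ (β (a ∨ c) ℕ.+ met js x) ≡ suc (length js)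
  count = begin
    fixed ℓ′ (suc j ∷ map suc js) ℕ.+ (β (a ∨ c) ℕ.+ met js x)
      ≡⟨ ℕ.+-assoc _ (β (a ∨ c)) (met js x) ⟨
    fixed ℓ′ (suc j ∷ map suc js) ℕ.+ β (a ∨ c) ℕ.+ met js x
      ≡⟨ cong (ℕ._+ met js x) (fixed-touched ℓ′ (suc j) (map suc js) (a ∨ c) (s≤s o)
           -- Distinctness of the labels: no later spike uses the vertex j + 1.
           (P (suc j) (s≤s o) (All.map (λ j≢ q → j≢ (ℕ.suc-injective q)) u) (a ∨ c) (proj₁ (proj₂ head)))) ⟩
    suc (fixed ℓ′ (map suc js)) ℕ.+ met js x
      ≡⟨ cong suc (proj₂ (proj₂ tail)) ⟩
    suc (length js) ∎

graphic-rank : ∀ js → Unique js → All (1 ≤_) js → ∀ X →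
  let es = (0 , 1) ∷ concatMap spike js in
  fixed (List.foldl mergeEdge id (selectEdges (Vec.fromList es) X)) (0 ∷ 1 ∷ map suc js) ℕ.+ ρ js X ≡ 2 ℕ.+ length js
graphic-rank js us os (b ∷ x) = start b
  where
  count : ∀ b ℓ → Roots ℓ b → All (λ j → ℓ (suc j) ≡ suc j) js →
    fixed (List.foldl mergeEdge ℓ (selected js x)) (0 ∷ 1 ∷ map suc js) ℕ.+ ρ js (b ∷ x) ≡ 2 ℕ.+ length js
  count b ℓ r es = let r′ , _ , c = spikes-run js x ℓ b us os es r in
    trans (sym (ℕ.+-assoc (fixed (List.foldl mergeEdge ℓ (selected js x)) (0 ∷ 1 ∷ map suc js)) (β (b ∨ both js x)) (met js x)))
          (trans (cong (ℕ._+ met js x) (fixed-roots (List.foldl mergeEdge ℓ (selected js x)) (b ∨ both js x) (map suc js) r′)) (cong (2 ℕ.+_) c))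
  start : ∀ b → fixed (List.foldl mergeEdge id (selectEdges (Vec.fromList ((0 , 1) ∷ concatMap spike js)) (b ∷ x))) (0 ∷ 1 ∷ map suc js)
                 ℕ.+ ρ js (b ∷ x) ≡ 2 ℕ.+ length js
  start false = count false id (refl , refl) (All.universal (λ _ → refl) js)
  -- The edge AB relabels vertex 1 only; as j ≥ 1, the outer vertices j + 1 are unaffected.
  start true  = count true (mergeEdge id (0 , 1)) (refl , s≤s z≤n) (All.map (λ { (s≤s _) → refl }) os)

-- The thagomizer matroid as the case of the full edge set.

pure-⊤ : ∀ js → Pure js ⊤
pure-⊤ []       = []
pure-⊤ (j ∷ js) = on (pure-⊤ js)

met-bound : ∀ js x → met js x ≤ #edges js
met-bound []       x           = z≤n
met-bound (j ∷ js) (a ∷ b ∷ x) with a ∨ b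
... | true  = s≤s (ℕ.m≤n⇒m≤1+n (met-bound js x))
... | false = ℕ.m≤n⇒m≤1+n (ℕ.m≤n⇒m≤1+n (met-bound js x))

thagomizer-rank : ∀ n X → rk (thagomizer n) X ≡ ρ (map suc (upTo n)) X
thagomizer-rank n X = begin
  2 ℕ.+ n ∸ components (2 ℕ.+ n) (selectEdges (Vec.fromList (thagoEdges n)) X)
    ≡⟨ cong₂ (λ k vs → k ∸ fixed ℓ vs) nv≡ vertices ⟩
  2 ℕ.+ length js ∸ c
    -- Components and rank add up to the number of vertices, so the subtraction in the definition of
    -- the rank is exact.
    ≡⟨ cong (_∸ c) (graphic-rank js unique positive X) ⟨
  c ℕ.+ ρ js X ∸ c
    ≡⟨ ℕ.m+n∸m≡n c (ρ js X) ⟩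
  ρ js X ∎
  where
  open ≡-Reasoning
  js = map suc (upTo n)
  ℓ = List.foldl mergeEdge id (selectEdges (Vec.fromList (thagoEdges n)) X)
  c = fixed ℓ (0 ∷ 1 ∷ map suc js)
  nv≡ : 2 ℕ.+ n ≡ 2 ℕ.+ length js
  nv≡ = cong (2 ℕ.+_) (sym (trans (List.length-map suc (upTo n)) (List.length-upTo n)))
  vertices : upTo (2 ℕ.+ n) ≡ 0 ∷ 1 ∷ map suc js
  vertices = cong (λ vs → 0 ∷ 1 ∷ vs) (sym (trans (cong (map suc) (List.map-upTo suc n)) (List.map-applyUpTo suc suc n)))
  unique : Unique js
  unique = Unique.map⁺ ℕ.suc-injective (Unique.upTo⁺ n)
  positive : All (1 ≤_) js
  positive = All.map⁺ (All.universal (λ _ → s≤s z≤n) (upTo n))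

invKL-thagomizer : ∀ n → coeff (invKL (thagomizer n)) ≗ qS (met (map suc (upTo n)) ⊤)
invKL-thagomizer n i = begin
  coeff (invKL (thagomizer n)) i
    ≡⟨ cong (λ p → coeff p i) (invKLaux-cong fuel (thagomizer n) (ρ js) (thagomizer-rank n)) ⟩
  coeff (invKLaux fuel (Mat js (true ∷ ⊤))) i
    ≡⟨ invKL-pure fuel (pure-⊤ js) (s≤s (ℕ.m≤n⇒m≤1+n (met-bound js ⊤))) i ⟩
  qS (met js ⊤) i ∎
  where
  open ≡-Reasoning
  js = map suc (upTo n)
  fuel = suc (m (thagomizer n))

theorem1p3 : (n : ℕ) → LogConcave (invKL (thagomizer (suc n)))
theorem1p3 n i
  rewrite invKL-thagomizer (suc n) i | invKL-thagomizer (suc n) (suc i) | invKL-thagomizer (suc n) (suc (suc i))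
  = qS-logConcave (met (map suc (upTo (suc n))) ⊤) i
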